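{- For every $n$-vertex $(4,1)$-tree $T$, the graph $G^2_T$ contains every $n$-vertex tree as a subgraph.
   Context: All trees are rooted with children of each vertex ordered left to right, and vertices are linearly ordered by DFS preorder traversal (visit root, then recursively the subtrees of its children from left to right). The level $L(u)$ is the distance to the root; a cousin of $u$ is another vertex of the same level; $u^*$ is the parent of $u$; siblings share a parent; "left" means earlier in DFS order. $D_T[u]$ is the set of descendants of $u$ including $u$, $D_T(u)=D_T[u]\setminus\{u\}$, $\nu(u)=|D_T[u]|$. The nearest left-cousin $l(u)$ is the last cousin of $u$ preceding $u$; the nearest right-cousin $r(u)$ is the first cousin following $u$ (when they exist). The $h$-th ancestor of $u$ is the vertex at distance $h$ above $u$, or the root if $h>L(u)$. A DFS-ordered tree $T$ is a $(K,s)$-tree if for every vertex $u$: (T1) if $l(l(u))$ exists then $\nu(l(l(u)))+\nu(l(u))\geq\nu(u)$; (T2) if $l(u)$ exists then $\nu(l(u))\geq\nu(u)/K$; (T3) if $u$ is not the rightmost vertex on its level then $\nu(u)\geq\nu(u')$ for every $u'$ with $L(u')\geq L(u)+s$; (T4) if $u$ has a child then $l(u)$ has a child. For $h\geq 0$, $G^h_T$ is the simple undirected graph on $V(T)$ in which, for every vertex $u$, $u$ is joined to: (G1) all $w\in D_T(u)$; (G2) every left-sibling $w$ of $u$ and all of $D_T(w)$; (G3) $w=l(u^*)$ and all of $D_T(w)$; (G4) with $u'$ the $h$-th ancestor of $u$: $u'$, each existing $w\in\{l(u'),r(u')\}$, and all $w\in D_T(l(u'))\cup D_T(u')\cup D_T(r(u'))$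 with $L(w)\leq L(u)$. -}

module Defs where

open import Data.Nat using (ℕ; zero; suc; _+_; _*_; _∸_; _≤_; _<_)
open import Data.List using (List; []; _∷_; _++_; _∷ʳ_; length; take)
open import Data.Maybe using (Maybe; just; nothing; maybe)
open import Data.Product using (Σ; _×_; _,_)
open import Data.Sum using (_⊎_)
open import Relation.Binary.PropositionalEquality using (_≡_; _≢_)
open import Relation.Nullary using (¬_)

-- Rooted trees with children ordered left to right (rose trees).
-- A vertex is identified with its address: the list of child indices
-- (0-based, left to right) on the path from the root.

data Tree : Set where
  node : List Tree → Tree

mutual
  size : Tree → ℕ
  size (node cs) = suc (sizeL cs)

  sizeL : List Tree → ℕ
  sizeL []       = 0
  sizeL (c ∷ cs) = size c + sizeL cs

mutual
  subtree : Tree → List ℕ → Maybe Tree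
  subtree t         []      = just t
  subtree (node cs) (i ∷ p) = subtreeL cs i p

  subtreeL : List Tree → ℕ → List ℕ → Maybe Tree
  subtreeL []       _       _ = nothing
  subtreeL (c ∷ cs) zero    p = subtree c p
  subtreeL (c ∷ cs) (suc i) p = subtreeL cs i p

Vertex : Tree → List ℕ → Set
Vertex t u = Σ Tree λ s → subtree t u ≡ just s

ν : Tree → List ℕ → ℕ
ν t u = maybe size 0 (subtree t u)

L : List ℕ → ℕ
L = length

-- DFS preorder on addresses: a vertex precedes its proper descendants,
-- otherwise compare at the first differing child index.
data _≺_ : List ℕ → List ℕ → Set where
  []≺   : ∀ {x xs} → [] ≺ (x ∷ xs)
  head≺ : ∀ {x y xs ys} → x < y → (x ∷ xs) ≺ (y ∷ ys)
  tail≺ : ∀ {x xs ys} → xs ≺ ys → (x ∷ xs) ≺ (x ∷ ys)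

-- w ∈ D_T[u]  (as addresses: u is a prefix of w)
_⊑_ : List ℕ → List ℕ → Set
u ⊑ w = Σ (List ℕ) λ q → u ++ q ≡ w

HasChild : Tree → List ℕ → Set
HasChild t u = Σ ℕ λ i → Vertex t (u ∷ʳ i)

NL : Tree → List ℕ → List ℕ → Set
NL t u v = Vertex t v × L v ≡ L u × v ≺ u ×
  (∀ w → Vertex t w → L w ≡ L u → v ≺ w → ¬ (w ≺ u))

NR : Tree → List ℕ → List ℕ → Set
NR t u v = Vertex t v × L v ≡ L u × u ≺ v ×
  (∀ w → Vertex t w → L w ≡ L u → u ≺ w → ¬ (w ≺ v))

NotRightmost : Tree → List ℕ → Set
NotRightmost t u = Σ (List ℕ) λ v → Vertex t v × L v ≡ L u × u ≺ v

record IsKsTree (K s : ℕ) (t : Tree) : Set where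
  field
    T1 : ∀ u v w → Vertex t u → NL t u v → NL t v w →
         ν t u ≤ ν t w + ν t v
    -- ν(l(u)) ≥ ν(u)/K, cleared of denominators
    T2 : ∀ u v → Vertex t u → NL t u v → ν t u ≤ K * ν t v
    T3 : ∀ u → Vertex t u → NotRightmost t u →
         ∀ u' → Vertex t u' → L u + s ≤ L u' → ν t u' ≤ ν t u
    T4 : ∀ u v → Vertex t u → HasChild t u → NL t u v → HasChild t v

-- h-th ancestor (the root if h > L(u))
anc : ℕ → List ℕ → List ℕ
anc h u = take (length u ∸ h) u

LeftSib : Tree → List ℕ → List ℕ → Set
LeftSib t u w = Vertex t w × Σ (List ℕ) λ p → Σ ℕ λ i → Σ ℕ λ j →
  u ≡ p ∷ʳ i × w ≡ p ∷ʳ j × j < i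

data Arc (h : ℕ) (t : Tree) (u w : List ℕ) : Set where
  G1 : u ⊑ w → u ≢ w → Arc h t u w
  G2 : (w' : List ℕ) → LeftSib t u w' → w' ⊑ w → Arc h t u w
  G3 : (p : List ℕ) (i : ℕ) → u ≡ p ∷ʳ i →
       (x : List ℕ) → NL t p x → x ⊑ w → Arc h t u w
  G4 : (x : List ℕ) →
       (x ≡ anc h u ⊎ NL t (anc h u) x ⊎ NR t (anc h u) x) →
       x ⊑ w → L w ≤ L u → Arc h t u w

Edge : ℕ → Tree → List ℕ → List ℕ → Set
Edge h t u w = Vertex t u × Vertex t w × u ≢ w × (Arc h t u w ⊎ Arc h t w u)

record ContainsTree (h : ℕ) (t S : Tree) : Set where
  field
    f     : List ℕ → List ℕ
    vert  : ∀ p → Vertex S p → Vertex t (f p)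
    inj   : ∀ p q → Vertex S p → Vertex S q → f p ≡ f q → p ≡ q
    edges : ∀ p i → Vertex S (p ∷ʳ i) → Edge h t (f p) (f (p ∷ʳ i))

{-# OPTIONS --safe #-}
module Submission where

-- Number the vertices of T in preorder. The statement proved by induction on the number of
-- vertices is: if the interval [a , k) contains at most one vertex of level i − 1, then every
-- tree S with as many vertices as [a , k) has vertices of level ≥ i embeds onto these vertices,
-- and the root of S can be sent to level i.
--
-- Let v be the last vertex of level i in [a , k), let v′ = l(v) and v″ = l(v′), let B be the number
-- of vertices of [a , k) below v and λ = ν(v′). By G1–G3, v is adjacent to everything in the
-- interval. If some vertex p of S has branches, avoiding the root, with B to B + λ − 1 vertices
-- altogether, then p goes to v, these branches fill the vertices below v and a final part of those
-- below v′, and the rest of S goes to what is left. Otherwise, for the last p on the heavy path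
-- whose subtree has more than B vertices, one puts the largest branches of p below v as long as
-- they fit, and cuts the next branch C: either at a vertex below which all subtrees are small, or
-- along the heavy path of C. B < 4λ (T2) guarantees that a cut of suitable size exists, so that
-- S falls apart at a single further vertex or edge. The ends of the edges so cut are kept on
-- levels i and i + 1, which form a clique by G4, and B < λ + ν(v″) (T1) leaves enough room for them.

open import Defs
open import Data.Nat using (ℕ; zero; suc; _+_; _*_; _∸_; _≤_; _<_; z≤n; s≤s; _≤?_; _<?_; _≟_; _≤′_; ≤′-refl; ≤′-step)
open import Data.Nat.Properties
open import Data.Nat.Tactic.RingSolver using (solve-∀)
open import Data.List using (List; []; _∷_; _++_; _∷ʳ_; length; map; [_]; take; drop)
open import Data.List.Properties using (length-++; length-map; length-take; map-++; ++-assoc; ++-identityʳ; ++-cancelˡ; take++drop≡id; ≡-dec)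
open import Data.List.Relation.Unary.Any using (here; there)
open import Data.List.Relation.Unary.All as All using (All; []; _∷_)
open import Data.List.Relation.Unary.All.Properties using (++⁺; ++⁻ˡ; ++⁻ʳ)
import Data.List.Relation.Unary.All.Properties as Allₚ
open import Data.List.Relation.Unary.AllPairs as AllPairs using (AllPairs; []; _∷_)
import Data.List.Relation.Unary.AllPairs.Properties as AllPairsₚ
open import Data.List.Relation.Unary.Unique.Propositional using (Unique)
import Data.List.Relation.Unary.Unique.Propositional.Properties as Uniqueₚ
open import Data.List.Membership.Propositional using (_∈_)
open import Data.List.Membership.Propositional.Properties using (∈-++⁺ˡ; ∈-++⁺ʳ; ∈-++⁻; ∈-map⁺; ∈-map⁻; ∈-length; ∈-∃++)
open import Data.List.Relation.Binary.Permutation.Propositional using (_↭_; ↭-refl; ↭-sym; ↭-trans; ↭-reflexive; prep)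
open import Data.List.Relation.Binary.Permutation.Propositional.Properties using (shift; ∈-resp-↭; ↭-length) renaming (++⁺ to ↭-++⁺)
open import Data.Maybe using (just; maybe)
open import Data.Product using (∃; ∃₂; _×_; _,_; proj₁; proj₂)
open import Data.Sum using (_⊎_; inj₁; inj₂) renaming (swap to ⊎-swap)
open import Data.Unit using (⊤; tt)
open import Function using (_∘_)
open import Relation.Nullary using (¬_; Dec; yes; no; contradiction)
open import Relation.Nullary.Decidable using (_×-dec_; decidable-stable)
open import Relation.Binary.Definitions using (tri<; tri≈; tri>)
open import Relation.Binary.PropositionalEquality using (_≡_; _≢_; refl; sym; trans; cong; cong₂; subst; subst₂; ≢-sym)

Address : Set
Address = List ℕ

-- For linear arithmetic: a ≤ b is the sum of the hypotheses and s the slack; the identity is left to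
-- the ring solver.
farkas : ∀ {x y a b} s → a ≤ b → x + b + s ≡ y + a → x ≤ y
farkas {x} {y} {a} {b} s a≤b eq = +-cancelʳ-≤ b x y
  (≤-trans (m≤m+n (x + b) s) (≤-trans (≤-reflexive eq) (+-monoʳ-≤ y a≤b)))

-- Intervals of preorder numbers, by level

consIf : ∀ {P : Set} → Dec P → ℕ → List ℕ → List ℕ
consIf (yes _) x xs = x ∷ xs
consIf (no _)  x xs = xs

module Levels (lev : ℕ → ℕ) where

  keep? : ∀ i a x → Dec (a ≤ x × i ≤ lev x)
  keep? i a x = (a ≤? x) ×-dec (i ≤? lev x)

  -- Listed from the right end. If `v` is the last vertex of level `i` before `k`, then `Il i v k`
  -- is the part of D[v] before `k`.
  Il : ℕ → ℕ → ℕ → List ℕ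
  Il i a zero    = []
  Il i a (suc k) = consIf (keep? i a k) k (Il i a k)

  count : ℕ → ℕ → ℕ → ℕ
  count i a k = length (Il i a k)

  NoLev : ℕ → ℕ → ℕ → Set
  NoLev i a k = ∀ x → a ≤ x → x < k → lev x ≢ i

  -- At most one vertex of level i − 1 in [a , k); no condition for i = 0.
  Pinched : ℕ → ℕ → ℕ → Set
  Pinched i a k = ∀ x y → a ≤ x → x < k → a ≤ y → y < k → suc (lev x) ≡ i → suc (lev y) ≡ i → x ≡ y

  Il-keep : ∀ i a k → a ≤ k → i ≤ lev k → Il i a (suc k) ≡ k ∷ Il i a k
  Il-keep i a k a≤k i≤ with keep? i a k
  ... | yes _ = refl
  ... | no ¬p = contradiction (a≤k , i≤) ¬p

  Il-drop : ∀ i a k → ¬ (a ≤ k × i ≤ lev k) → Il i a (suc k) ≡ Il i a k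
  Il-drop i a k ¬p with keep? i a k
  ... | yes p = contradiction p ¬p
  ... | no _ = refl

  ∈-Il⁻ : ∀ i a k {x} → x ∈ Il i a k → a ≤ x × x < k × i ≤ lev x
  ∈-Il⁻ i a (suc k) x∈ with keep? i a k
  ∈-Il⁻ i a (suc k) (here refl) | yes (p , q) = p , n<1+n k , q
  ∈-Il⁻ i a (suc k) (there x∈)  | yes _ = let (p , q , r) = ∈-Il⁻ i a k x∈ in p , m<n⇒m<1+n q , r
  ∈-Il⁻ i a (suc k) x∈          | no _  = let (p , q , r) = ∈-Il⁻ i a k x∈ in p , m<n⇒m<1+n q , r

  ∈-Il⁺ : ∀ i a k {x} → a ≤ x → x < k → i ≤ lev x → x ∈ Il i a k
  ∈-Il⁺ i a (suc k) {x} p (s≤s q) r with keep? i a k | m≤n⇒m<n∨m≡n q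
  ... | yes _ | inj₁ x<k  = there (∈-Il⁺ i a k p x<k r)
  ... | yes _ | inj₂ refl = here refl
  ... | no _  | inj₁ x<k  = ∈-Il⁺ i a k p x<k r
  ... | no ¬p | inj₂ refl = contradiction (p , r) ¬p

  Il-empty : ∀ i a k → k ≤ a → Il i a k ≡ []
  Il-empty i a zero    k≤a = refl
  Il-empty i a (suc k) k<a = trans (Il-drop i a k (λ p → <⇒≱ k<a (proj₁ p))) (Il-empty i a k (<⇒≤ k<a))

  Il-split : ∀ i {a b k} → a ≤ b → b ≤ k → Il i a k ≡ Il i b k ++ Il i a b
  Il-split i {a} {b} {k} a≤b b≤k = go (≤⇒≤′ b≤k)
    where
    go : ∀ {k} → b ≤′ k → Il i a k ≡ Il i b k ++ Il i a b
    go ≤′-refl = cong (_++ Il i a b) (sym (Il-empty i b b ≤-refl))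
    go (≤′-step {k} b≤′k) = step (i ≤? lev k)
      where
      b≤k′ = ≤′⇒≤ b≤′k
      step : Dec (i ≤ lev k) → Il i a (suc k) ≡ Il i b (suc k) ++ Il i a b
      step (yes p) = trans (Il-keep i a k (≤-trans a≤b b≤k′) p)
                       (trans (cong (k ∷_) (go b≤′k)) (cong (_++ Il i a b) (sym (Il-keep i b k b≤k′ p))))
      step (no ¬p) = trans (Il-drop i a k (λ p → ¬p (proj₂ p)))
                       (trans (go b≤′k) (cong (_++ Il i a b) (sym (Il-drop i b k (λ p → ¬p (proj₂ p))))))

  count-empty : ∀ i k → count i k k ≡ 0
  count-empty i k = cong length (Il-empty i k k ≤-refl)

  count-split : ∀ i {a b k} → a ≤ b → b ≤ k → count i a k ≡ count i b k + count i a b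
  count-split i {a} {b} {k} a≤b b≤k =
    trans (cong length (Il-split i a≤b b≤k)) (length-++ (Il i b k))

  Il-suc : ∀ i a k → NoLev i a k → Il i a k ≡ Il (suc i) a k
  Il-suc i a zero    no-lev = refl
  Il-suc i a (suc k) no-lev with keep? i a k | keep? (suc i) a k
  ... | yes _ | yes _ = cong (k ∷_) (Il-suc i a k (λ x p q → no-lev x p (m<n⇒m<1+n q)))
  ... | yes (p , q) | no ¬p = contradiction (p , ≤∧≢⇒< q (λ e → no-lev k p (n<1+n k) (sym e))) ¬p
  ... | no ¬p | yes (p , q) = contradiction (p , <⇒≤ q) ¬p
  ... | no _ | no _ = Il-suc i a k (λ x p q → no-lev x p (m<n⇒m<1+n q))

  NoLev-sub : ∀ {i a b k l} → a ≤ b → l ≤ k → NoLev i a k → NoLev i b l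
  NoLev-sub a≤b l≤k no-lev x p q = no-lev x (≤-trans a≤b p) (<-≤-trans q l≤k)

  -- The passage from level `i` to `i + 1`: without its only vertex of level `i`, the set keeps
  -- exactly its vertices of higher level and is again of the shape `Il`.
  Il-hole : ∀ i {b v k} → b ≤ v → v < k → lev v ≡ i → NoLev i b v → NoLev i (suc v) k →
            Il i b k ↭ v ∷ Il (suc i) b k
  Il-hole i {b} {v} {k} b≤v v<k refl nl₁ nl₂ =
    ↭-trans (↭-reflexive eq₁) (↭-trans (shift v _ _) (↭-reflexive (cong (v ∷_) eq₂)))
    where
    b≤sv = m≤n⇒m≤1+n b≤v
    eq₁ : Il i b k ≡ Il i (suc v) k ++ v ∷ Il i b v
    eq₁ = trans (Il-split i b≤sv v<k) (cong (Il i (suc v) k ++_) (Il-keep i b v b≤v ≤-refl))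
    eq₂ : Il i (suc v) k ++ Il i b v ≡ Il (suc i) b k
    eq₂ = trans (cong₂ _++_ (Il-suc i (suc v) k nl₂) (Il-suc i b v nl₁))
            (trans (cong (Il (suc i) (suc v) k ++_) (sym (Il-drop (suc i) b v (λ p → <-irrefl refl (proj₂ p)))))
              (sym (Il-split (suc i) b≤sv v<k)))

  count-hole : ∀ i {b v k} → b ≤ v → v < k → lev v ≡ i → NoLev i b v → NoLev i (suc v) k →
               count i b k ≡ suc (count (suc i) b k)
  count-hole i b≤v v<k e nl₁ nl₂ = ↭-length (Il-hole i b≤v v<k e nl₁ nl₂)

  count-next : ∀ i b k → count i b k ≤ suc (count i (suc b) k)
  count-next i b k = go (suc b ≤? k)
    where
    one : count i b (suc b) ≤ 1
    one with keep? i b b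
    ... | yes _ = s≤s (≤-reflexive (cong length (Il-empty i b b ≤-refl)))
    ... | no _  = ≤-trans (≤-reflexive (cong length (Il-empty i b b ≤-refl))) z≤n
    go : Dec (suc b ≤ k) → count i b k ≤ suc (count i (suc b) k)
    go (no b≮k)  = ≤-trans (≤-reflexive (cong length (Il-empty i b k (≮⇒≥ b≮k)))) z≤n
    go (yes b<k) = ≤-trans (≤-reflexive (count-split i (n≤1+n b) b<k))
          (≤-trans (+-monoʳ-≤ (count i (suc b) k) one) (≤-reflexive (+-comm _ 1)))

  -- Discrete intermediate values: moving the left end by one changes the count by at most one, so a
  -- piece of prescribed size can be split off at the right end.
  cut-at : ∀ i {lo hi} k g → lo ≤ hi → count i hi k ≤ g → g ≤ count i lo k →
           ∃ λ b → lo ≤ b × b ≤ hi × count i b k ≡ g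
  cut-at i {lo} {hi} k g lo≤hi = go (≤⇒≤′ lo≤hi)
    where
    go : ∀ {hi} → lo ≤′ hi → count i hi k ≤ g → g ≤ count i lo k →
         ∃ λ b → lo ≤ b × b ≤ hi × count i b k ≡ g
    go ≤′-refl p q = lo , ≤-refl , ≤-refl , ≤-antisym p q
    go (≤′-step {h} lo≤′h) p q with count i h k ≤? g
    ... | yes r = let (b , x , y , z) = go lo≤′h r q in b , x , m≤n⇒m≤1+n y , z
    ... | no ¬r = suc h , m≤n⇒m≤1+n (≤′⇒≤ lo≤′h) , ≤-refl ,
                  ≤-antisym p (≤-pred (≤-trans (≰⇒> ¬r) (count-next i h k)))

  last-lev : ∀ i a k → (∃ λ v → a ≤ v × v < k × lev v ≡ i × NoLev i (suc v) k) ⊎ NoLev i a k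
  last-lev i a zero = inj₂ (λ x _ ())
  last-lev i a (suc k) with a ≤? k | lev k ≟ i
  ... | yes p | yes q = inj₁ (k , p , n<1+n k , q , λ x sk≤x x<sk → contradiction (≤-pred x<sk) (<⇒≱ sk≤x))
  ... | no p  | _ = inj₂ (λ x a≤x x<sk → contradiction (≤-trans a≤x (≤-pred x<sk)) p)
  ... | yes p | no q with last-lev i a k
  ...   | inj₁ (v , r , s , t , u) = inj₁ (v , r , m<n⇒m<1+n s , t , extend u)
    where
    extend : NoLev i (suc v) k → NoLev i (suc v) (suc k)
    extend u x sv≤x x<sk with m≤n⇒m<n∨m≡n (≤-pred x<sk)
    ... | inj₁ x<k  = u x sv≤x x<k
    ... | inj₂ refl = q
  ...   | inj₂ u = inj₂ extend
    where
    extend : NoLev i a (suc k)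
    extend x a≤x x<sk with m≤n⇒m<n∨m≡n (≤-pred x<sk)
    ... | inj₁ x<k  = u x a≤x x<k
    ... | inj₂ refl = q

  count-above : ∀ i {v k} → lev v ≡ i → count (suc i) (suc v) k ≡ count (suc i) v k
  count-above i {v} {k} refl with suc v ≤? k
  ... | yes v<k = sym (trans (count-split (suc i) (n≤1+n v) v<k)
                   (trans (cong (λ l → count (suc i) (suc v) k + length l)
                     (trans (Il-drop (suc i) v v (λ p → <-irrefl refl (proj₂ p))) (Il-empty (suc i) v v ≤-refl)))
                     (+-identityʳ _)))
  ... | no v≮k = cong length (trans (Il-empty (suc i) (suc v) k (m≤n⇒m≤1+n (≮⇒≥ v≮k)))
                   (sym (Il-empty (suc i) v k (≮⇒≥ v≮k))))

  count-first : ∀ i {v k} → v < k → lev v ≡ i → NoLev i (suc v) k → count i v k ≡ suc (count (suc i) (suc v) k)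
  count-first i {v} {k} v<k lv nl = trans (count-hole i ≤-refl v<k lv (λ x p q → contradiction p (<⇒≱ q)) nl)
    (cong suc (sym (count-above i {v} {k} lv)))

  Pinched-sub : ∀ {i a b k l} → a ≤ b → l ≤ k → Pinched i a k → Pinched i b l
  Pinched-sub a≤b l≤k w x y p q r s = w x y (≤-trans a≤b p) (<-≤-trans q l≤k) (≤-trans a≤b r) (<-≤-trans s l≤k)

  -- What lets the induction restart one level higher on a piece in which `v` is the only vertex of
  -- level `i`.
  Pinched-hole : ∀ {i b v k} → NoLev i b v → NoLev i (suc v) k → Pinched (suc i) b k
  Pinched-hole {i} {b} {v} {k} nl₁ nl₂ x y p q r s e f =
    trans (only x p q (suc-injective e)) (sym (only y r s (suc-injective f)))
    where
    only : ∀ x → b ≤ x → x < k → lev x ≡ i → x ≡ v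
    only x p q e with <-cmp x v
    ... | tri< x<v _ _ = contradiction e (nl₁ x p x<v)
    ... | tri≈ _ x≡v _ = x≡v
    ... | tri> _ _ v<x = contradiction e (nl₂ x v<x q)

  Pinched-none : ∀ {i b k} → NoLev i b k → Pinched (suc i) b k
  Pinched-none nl x y p q r s e f = contradiction (suc-injective e) (nl x p q)

  length-pos : ∀ {X : Set} {xs : List X} → 1 ≤ length xs → ∃ λ x → x ∈ xs
  length-pos {xs = x ∷ xs} _ = x , here refl

  count-pos⁻ : ∀ i a k → 1 ≤ count i a k → ∃ λ x → a ≤ x × x < k × i ≤ lev x
  count-pos⁻ i a k p = let (x , x∈) = length-pos p in x , ∈-Il⁻ i a k x∈

-- Labelled trees and the heavy path

suc-swap : ∀ a b c → suc (a + b) + c ≡ a + suc (b + c)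
suc-swap a b c = trans (cong suc (+-assoc a b c)) (sym (+-suc a (b + c)))

+-left-comm : ∀ a b c → a + (b + c) ≡ b + (a + c)
+-left-comm a b c = trans (sym (+-assoc a b c)) (trans (cong (_+ c) (+-comm a b)) (+-assoc b a c))

-- The labels are the vertices of the tree to be embedded; they survive when branches are sorted,
-- merged or re-rooted.
data LTree : Set where
  node : Address → List LTree → LTree

module Trees where

  Forest : Set
  Forest = List (LTree)

  root : LTree → Address
  root (node x _) = x

  mutual
    ⟨_⟩ : LTree → ℕ
    ⟨ node _ ts ⟩ = suc ⟪ ts ⟫

    ⟪_⟫ : Forest → ℕ
    ⟪ [] ⟫     = 0
    ⟪ t ∷ ts ⟫ = ⟨ t ⟩ + ⟪ ts ⟫

  ⟪++⟫ : ∀ ts us → ⟪ ts ++ us ⟫ ≡ ⟪ ts ⟫ + ⟪ us ⟫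
  ⟪++⟫ []       us = refl
  ⟪++⟫ (t ∷ ts) us = trans (cong (⟨ t ⟩ +_) (⟪++⟫ ts us)) (sym (+-assoc ⟨ t ⟩ ⟪ ts ⟫ ⟪ us ⟫))

  ⟨t⟩>0 : ∀ t → 1 ≤ ⟨ t ⟩
  ⟨t⟩>0 (node _ _) = s≤s z≤n

  -- A context, listed from the hole upwards: each frame is a vertex on the
  -- path from the hole to the root together with its children off the path.
  Ctx : Set
  Ctx = List (Address × Forest)

  -- The hole comes first among the children, so that in a sorted tree a context follows the heavy
  -- path.
  plug : Ctx → LTree → LTree
  plug []            t = t
  plug ((x , ts) ∷ K) t = plug K (node x (t ∷ ts))

  ⟦_⟧ : Ctx → ℕ
  ⟦ [] ⟧            = 0
  ⟦ (_ , ts) ∷ K ⟧ = suc (⟪ ts ⟫ + ⟦ K ⟧)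

  ⟨plug⟩ : ∀ K t → ⟨ plug K t ⟩ ≡ ⟨ t ⟩ + ⟦ K ⟧
  ⟨plug⟩ []             t = sym (+-identityʳ _)
  ⟨plug⟩ ((x , ts) ∷ K) t = trans (⟨plug⟩ K (node x (t ∷ ts))) (suc-swap ⟨ t ⟩ ⟪ ts ⟫ ⟦ K ⟧)

  -- What remains of plug K _ when the subtree at the hole is cut off, with
  -- the forest us hung on the vertex above the hole: at its old root, and
  -- re-rooted at the vertex above the hole.
  trim : Ctx → Forest → Forest
  trim []             us = us
  trim ((x , ts) ∷ K) us = [ plug K (node x (ts ++ us)) ]

  ups : Ctx → Forest
  ups []             = []
  ups ((x , ts) ∷ K) = [ node x (ts ++ ups K) ]

  ⟪trim⟫ : ∀ K us → ⟪ trim K us ⟫ ≡ ⟪ us ⟫ + ⟦ K ⟧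
  ⟪trim⟫ []             us = sym (+-identityʳ _)
  ⟪trim⟫ ((x , ts) ∷ K) us = trans (+-identityʳ _) (trans (⟨plug⟩ K (node x (ts ++ us)))
    (trans (cong (λ s → suc s + ⟦ K ⟧) (trans (⟪++⟫ ts us) (+-comm ⟪ ts ⟫ ⟪ us ⟫)))
      (suc-swap ⟪ us ⟫ ⟪ ts ⟫ ⟦ K ⟧)))

  ⟪ups⟫ : ∀ K → ⟪ ups K ⟫ ≡ ⟦ K ⟧
  ⟪ups⟫ []             = refl
  ⟪ups⟫ ((x , ts) ∷ K) = trans (+-identityʳ _)
    (cong suc (trans (⟪++⟫ ts (ups K)) (cong (⟪ ts ⟫ +_) (⟪ups⟫ K))))

  -- As ups, with the root of plug K _ deleted.
  ups⁻ : Ctx → Forest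
  ups⁻ []                   = []
  ups⁻ ((x , ts) ∷ [])      = ts
  ups⁻ ((x , ts) ∷ K@(_ ∷ _)) = [ node x (ts ++ ups⁻ K) ]

  ⟪ups⁻⟫ : ∀ f K → suc ⟪ ups⁻ (f ∷ K) ⟫ ≡ ⟦ f ∷ K ⟧
  ⟪ups⁻⟫ (x , ts) []      = cong suc (sym (+-identityʳ _))
  ⟪ups⁻⟫ (x , ts) (g ∷ K) = cong suc (trans (+-identityʳ _)
    (trans (cong suc (⟪++⟫ ts (ups⁻ (g ∷ K))))
      (trans (sym (+-suc ⟪ ts ⟫ _)) (cong (⟪ ts ⟫ +_) (⟪ups⁻⟫ g K)))))

  Desc : Forest → Set
  Desc []       = ⊤
  Desc (t ∷ ts) = All (λ u → ⟨ u ⟩ ≤ ⟨ t ⟩) ts × Desc ts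

  data Sorted : LTree → Set where
    sorted : ∀ {x ts} → Desc ts → All Sorted ts → Sorted (node x ts)

  insert : LTree → Forest → Forest
  insert t [] = [ t ]
  insert t (u ∷ us) with ⟨ u ⟩ ≤? ⟨ t ⟩
  ... | yes _ = t ∷ u ∷ us
  ... | no _  = u ∷ insert t us

  module _ {P : LTree → Set} where
    All-insert⁺ : ∀ t us → P t → All P us → All P (insert t us)
    All-insert⁺ t [] p ps = p ∷ []
    All-insert⁺ t (u ∷ us) p (q ∷ ps) with ⟨ u ⟩ ≤? ⟨ t ⟩
    ... | yes _ = p ∷ q ∷ ps
    ... | no _  = q ∷ All-insert⁺ t us p ps

    All-insert⁻ : ∀ t us → All P (insert t us) → All P (t ∷ us)
    All-insert⁻ t [] ps = ps
    All-insert⁻ t (u ∷ us) ps with ⟨ u ⟩ ≤? ⟨ t ⟩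
    All-insert⁻ t (u ∷ us) ps       | yes _ = ps
    All-insert⁻ t (u ∷ us) (q ∷ ps) | no _ with All-insert⁻ t us ps
    ... | p ∷ rs = p ∷ q ∷ rs

  ⟪insert⟫ : ∀ t us → ⟪ insert t us ⟫ ≡ ⟨ t ⟩ + ⟪ us ⟫
  ⟪insert⟫ t [] = refl
  ⟪insert⟫ t (u ∷ us) with ⟨ u ⟩ ≤? ⟨ t ⟩
  ... | yes _ = refl
  ... | no _  = trans (cong (⟨ u ⟩ +_) (⟪insert⟫ t us)) (+-left-comm ⟨ u ⟩ ⟨ t ⟩ ⟪ us ⟫)

  Desc-insert : ∀ t us → Desc us → Desc (insert t us)
  Desc-insert t [] _ = [] , tt
  Desc-insert t (u ∷ us) (p , d) with ⟨ u ⟩ ≤? ⟨ t ⟩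
  ... | yes q = (q ∷ All.map (λ r → ≤-trans r q) p) , p , d
  ... | no q  = All-insert⁺ t us (<⇒≤ (≰⇒> q)) p , Desc-insert t us d

  mutual
    sort : LTree → LTree
    sort (node x ts) = node x (sort* ts)

    sort* : Forest → Forest
    sort* []       = []
    sort* (t ∷ ts) = insert (sort t) (sort* ts)

  root-sort : ∀ t → root (sort t) ≡ root t
  root-sort (node x ts) = refl

  mutual
    ⟨sort⟩ : ∀ t → ⟨ sort t ⟩ ≡ ⟨ t ⟩
    ⟨sort⟩ (node x ts) = cong suc (⟪sort⟫ ts)

    ⟪sort⟫ : ∀ ts → ⟪ sort* ts ⟫ ≡ ⟪ ts ⟫
    ⟪sort⟫ []       = refl
    ⟪sort⟫ (t ∷ ts) = trans (⟪insert⟫ (sort t) (sort* ts)) (cong₂ _+_ (⟨sort⟩ t) (⟪sort⟫ ts))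

  mutual
    sort-sorted : ∀ t → Sorted (sort t)
    sort-sorted (node x ts) = let (d , s) = sort*-sorted ts in sorted d s

    sort*-sorted : ∀ ts → Desc (sort* ts) × All Sorted (sort* ts)
    sort*-sorted []       = tt , []
    sort*-sorted (t ∷ ts) = let (d , s) = sort*-sorted ts in
      Desc-insert (sort t) (sort* ts) d , All-insert⁺ (sort t) (sort* ts) (sort-sorted t) s

  -- The last subtree on the heavy path with more than N vertices; in a sorted tree the heavy path
  -- follows the first children.
  record Heavy (N : ℕ) (t : LTree) : Set where
    constructor heavy
    field
      ctx    : Ctx
      vertex : Address
      below  : Forest
      eq     : t ≡ plug ctx (node vertex below)
      desc   : Desc below
      srt    : All Sorted below
      small  : All (λ u → ⟨ u ⟩ ≤ N) below
      big    : N ≤ ⟪ below ⟫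

  -- Descend into the first child as long as it has more than `N` vertices. The first child is the
  -- largest, so where the descent stops no branch has more than `N`.
  findHeavy : ∀ N K t → Sorted t → N < ⟨ t ⟩ → Heavy N (plug K t)
  findHeavy N K (node x []) (sorted d s) (s≤s N≤) = heavy K x [] refl d s [] N≤
  findHeavy N K (node x (t ∷ ts)) (sorted (p , d) (s ∷ ss)) (s≤s N≤) with suc N ≤? ⟨ t ⟩
  ... | yes N<t = findHeavy N ((x , ts) ∷ K) t s N<t
  ... | no N≮t  = heavy K x (t ∷ ts) refl (p , d) (s ∷ ss)
                    (≮⇒≥ N≮t ∷ All.map (λ q → ≤-trans q (≮⇒≥ N≮t)) p) N≤

  -- Branches are taken in the given order until `N` vertices are reached; `mid` is the branch that
  -- reaches them.
  record Greedy (N : ℕ) (ts : Forest) : Set where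
    constructor greedy
    field
      pre    : Forest
      mid    : LTree
      post   : Forest
      eq     : ts ≡ pre ++ mid ∷ post
      pre<   : ⟪ pre ⟫ < N
      ≤mid   : N ≤ ⟪ pre ⟫ + ⟨ mid ⟩
      mid-min : All (λ u → ⟨ mid ⟩ ≤ ⟨ u ⟩) pre

  findGreedy : ∀ N ts → Desc ts → 1 ≤ N → N ≤ ⟪ ts ⟫ → Greedy N ts
  findGreedy (suc N) [] d _ ()
  findGreedy (suc N) (t ∷ ts) (p , d) _ N≤ with suc N ≤? ⟨ t ⟩
  ... | yes q = greedy [] t ts refl (s≤s z≤n) q []
  ... | no q  with findGreedy (suc N ∸ ⟨ t ⟩) ts d (m<n⇒0<n∸m (≰⇒> q))
                     (≤-trans (∸-monoˡ-≤ ⟨ t ⟩ N≤) (≤-reflexive (m+n∸m≡n ⟨ t ⟩ _)))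
  ... | greedy us m vs refl u< ≤m mn = greedy (t ∷ us) m vs refl
          (≤-trans (≤-reflexive (sym (+-suc ⟨ t ⟩ _))) (≤-trans (+-monoʳ-≤ ⟨ t ⟩ u<) (≤-reflexive (m+[n∸m]≡n t≤))))
          (≤-trans (≤-reflexive (sym (m+[n∸m]≡n t≤)))
             (≤-trans (+-monoʳ-≤ ⟨ t ⟩ ≤m) (≤-reflexive (sym (+-assoc ⟨ t ⟩ _ _)))))
          (All.head (++⁻ʳ us p) ∷ mn)
    where t≤ = <⇒≤ (≰⇒> q)

-- Cutting a branch at a vertex or an edge

deep-bound : ∀ p m N l → p < N → m ≤ N → N < l → 2 + (p + (m + 0)) ≤ N + l
deep-bound p m N l h₁ h₂ h₃ = farkas 0 (+-mono-≤ h₁ (+-mono-≤ h₂ h₃)) (eq p m N l)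
  where
  eq : ∀ p m N l → 2 + (p + (m + 0)) + (N + (N + l)) + 0 ≡ N + l + (suc p + (m + suc N))
  eq = solve-∀

leaf-absurd : ∀ κ N l → κ < N → 2 ≤ l → ¬ (N + l ≤ 1 + κ)
leaf-absurd κ N l h₁ h₂ h₃ = <-irrefl refl
  (farkas {suc κ} {κ} 1 (+-mono-≤ h₁ (+-mono-≤ h₂ h₃)) (eq κ N l))
  where
  eq : ∀ κ N l → suc κ + (N + (l + (1 + κ))) + 1 ≡ κ + (suc κ + (2 + (N + l)))
  eq = solve-∀

-- Suppose the branch of size `m` overshoots. Since `κ + p < N`, it has at least `l` vertices, and
-- so has the heavier branch of size `h`; with `N ≥ l`, the tree and `N` together reach `4 * l`.
wide-absurd : ∀ κ p m q h N l → κ + p < N → m ≤ h → l ≤ N → N + l ≤ 1 + (κ + (p + (m + 0))) →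
              ¬ (suc (h + (p + (m + q))) + κ + N < 4 * l)
wide-absurd κ p m q h N l h₁ h₂ h₃ h₄ h₅ = <-irrefl refl (≤-trans h₅
  (farkas q (+-mono-≤ l≤m (+-mono-≤ h₂ (+-mono-≤ h₃ (+-mono-≤ h₃ h₄)))) (eq₂ κ p m q h N l)))
  where
  eq₁ : ∀ κ p m N l → l + (N + (1 + (κ + (p + (m + 0))))) + 0 ≡ m + (suc (κ + p) + (N + l))
  eq₁ = solve-∀
  l≤m : l ≤ m
  l≤m = farkas 0 (+-mono-≤ h₁ h₄) (eq₁ κ p m N l)
  eq₂ : ∀ κ p m q h N l → 4 * l + (m + (h + (N + (N + (1 + (κ + (p + (m + 0)))))))) + q ≡
        suc (h + (p + (m + q))) + κ + N + (l + (m + (l + (l + (N + l)))))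
  eq₂ = solve-∀

module Cuts where
  open Trees

  -- Ways to cut a set of between N and N + l − 2 vertices off a tree: some of the subtrees below
  -- a vertex y; everything but the subtree of h; or everything outside the subtree of q
  -- together with some of the subtrees below q.
  data Cut (N l : ℕ) (t : LTree) : Set where
    deep : ∀ K y X Y → t ≡ plug K (node y (X ++ Y)) → N ≤ ⟪ X ⟫ → 2 + ⟪ X ⟫ ≤ N + l → Cut N l t
    edge : ∀ K q h ts → t ≡ plug K (node q (h ∷ ts)) → suc (⟪ ts ⟫ + ⟦ K ⟧) ≡ N → Cut N l t
    wide : ∀ K q h X Y → t ≡ plug K (node q (h ∷ X ++ Y)) → N ≤ ⟦ K ⟧ + ⟪ X ⟫ →
           2 + (⟦ K ⟧ + ⟪ X ⟫) ≤ N + l → Cut N l t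

  module _ (N l : ℕ) (1≤N : 1 ≤ N) (2≤l : 2 ≤ l) where

    -- Going down the heavy path, the part outside the next branch `h` grows. When it first reaches
    -- `N`, either it has exactly `N` vertices and the edge to `h` is cut, or it is larger and the
    -- other branches at `q` are added to the context one by one; the bound by `4 * l` keeps the
    -- last of them from overshooting.
    walk : l ≤ N → ∀ K t → Sorted t → ⟦ K ⟧ < N → N + l ≤ ⟨ plug K t ⟩ → ⟨ plug K t ⟩ + N < 4 * l →
           Cut N l (plug K t)
    walk l≤N K (node q []) _ K<N lo hi =
      contradiction (≤-trans lo (≤-reflexive (⟨plug⟩ K (node q [])))) (leaf-absurd ⟦ K ⟧ N l K<N 2≤l)
    walk l≤N K (node q (h ∷ ts)) (sorted (h-max , d) (s ∷ _)) K<N lo hi with <-cmp (suc (⟪ ts ⟫ + ⟦ K ⟧)) N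
    ... | tri< lt _ _ = walk l≤N ((q , ts) ∷ K) h s lt lo hi
    ... | tri≈ _ eq _ = edge K q h ts refl eq
    ... | tri> _ _ gt with findGreedy (N ∸ ⟦ K ⟧) ts d (m<n⇒0<n∸m K<N)
                             (≤-trans (∸-monoˡ-≤ ⟦ K ⟧ (≤-pred gt)) (≤-reflexive (m+n∸n≡m ⟪ ts ⟫ ⟦ K ⟧)))
    ... | greedy P M Q refl P< ≤M _ with 2 + (⟦ K ⟧ + ⟪ P ++ [ M ] ⟫) ≤? N + l
    ...   | yes ok = wide K q h (P ++ [ M ]) Q (cong (λ us → plug K (node q (h ∷ us))) (sym (++-assoc P [ M ] Q)))
                       (≤-trans (≤-reflexive (sym K+N)) (+-monoʳ-≤ ⟦ K ⟧ (≤-trans ≤M (≤-reflexive (trans (cong (⟪ P ⟫ +_) (sym (+-identityʳ ⟨ M ⟩))) (sym (⟪++⟫ P [ M ])))))))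
                       ok
      where K+N = m+[n∸m]≡n (<⇒≤ K<N)
    ...   | no ¬ok = contradiction
              (subst (λ s → s + N < 4 * l) (trans (⟨plug⟩ K (node q (h ∷ P ++ M ∷ Q))) (cong (λ s → suc (⟨ h ⟩ + s) + ⟦ K ⟧) (⟪++⟫ P (M ∷ Q)))) hi)
              (wide-absurd ⟦ K ⟧ ⟪ P ⟫ ⟨ M ⟩ ⟪ Q ⟫ ⟨ h ⟩ N l
                (≤-trans (≤-reflexive (sym (+-suc ⟦ K ⟧ ⟪ P ⟫))) (≤-trans (+-monoʳ-≤ ⟦ K ⟧ P<) (≤-reflexive (m+[n∸m]≡n (<⇒≤ K<N)))))
                (All.head (++⁻ʳ P h-max)) l≤N
                (≤-pred (≤-trans (≰⇒> ¬ok) (≤-reflexive (cong (λ s → 2 + (⟦ K ⟧ + s)) (⟪++⟫ P [ M ]))))))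

    -- For `N < l`, a branch of at most `N` vertices can be added to fewer than `N` vertices without
    -- exceeding the upper bound, so branches are collected at the last heavy vertex. Otherwise the
    -- cut follows the heavy path.
    cut : ∀ t → Sorted t → N + l ≤ ⟨ t ⟩ → ⟨ t ⟩ + N < 4 * l → Cut N l t
    cut t st lo hi with N <? l
    ... | no N≮l = walk (≮⇒≥ N≮l) [] t st 1≤N lo hi
    ... | yes N<l with findHeavy N [] t st
                         (≤-trans (≤-trans (≤-reflexive (+-comm 1 N)) (+-monoʳ-≤ N (≤-trans (n≤1+n 1) 2≤l))) lo)
    ...   | heavy K y ts refl d _ small big with findGreedy N ts d 1≤N big
    ...     | greedy P M Q refl P< ≤M _ = deep K y (P ++ [ M ]) Q
                (cong (λ us → plug K (node y us)) (sym (++-assoc P [ M ] Q)))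
                (≤-trans ≤M (≤-reflexive (sym sz′)))
                (≤-trans (≤-reflexive (cong (2 +_) sz)) (deep-bound ⟪ P ⟫ ⟨ M ⟩ N l P< (All.head (++⁻ʳ P small)) N<l))
      where
      sz : ⟪ P ++ [ M ] ⟫ ≡ ⟪ P ⟫ + (⟨ M ⟩ + 0)
      sz = ⟪++⟫ P [ M ]
      sz′ : ⟪ P ++ [ M ] ⟫ ≡ ⟪ P ⟫ + ⟨ M ⟩
      sz′ = trans sz (cong (⟪ P ⟫ +_) (+-identityʳ ⟨ M ⟩))

-- Placements of a labelled tree

module Realise (_~_ : ℕ → ℕ → Set) (~-sym : ∀ {x y} → x ~ y → y ~ x) where

  open Trees

  -- A list of pairs and not a function, so that placements of parts are combined by concatenation.
  -- That no label and no number has two partners is recovered at the end by counting.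
  Placement : Set
  Placement = List (Address × ℕ)

  infix 4 _⊑ˡ_
  _⊑ˡ_ : Placement → Placement → Set
  L ⊑ˡ M = ∀ {e} → e ∈ L → e ∈ M

  At : Placement → Address → (ℕ → Set) → Set
  At L x P = ∃ λ j → (x , j) ∈ L × P j

  Placed : Placement → Address → Set
  Placed L x = At L x (λ _ → ⊤)

  Joined : Placement → Address → Address → Set
  Joined L x y = ∃ λ j → ∃ λ l → (x , j) ∈ L × (y , l) ∈ L × j ~ l

  data Real (L : Placement) : LTree → Set where
    real : ∀ {x ts} → Placed L x → All (λ t → Joined L x (root t) × Real L t) ts → Real L (node x ts)

  Real* : Placement → Forest → Set
  Real* L = All (Real L)

  Hung : Placement → Address → Forest → Set
  Hung L x = All (λ t → Joined L x (root t) × Real L t)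

  RealC : Placement → Ctx → Address → Set
  RealC L []             y = ⊤
  RealC L ((x , ts) ∷ K) y = Joined L x y × Placed L x × Hung L x ts × RealC L K x

  Joined-sym : ∀ {L x y} → Joined L x y → Joined L y x
  Joined-sym (j , l , p , q , e) = l , j , q , p , ~-sym e

  Real⇒Placed : ∀ {L t} → Real L t → Placed L (root t)
  Real⇒Placed (real p _) = p

  Hung⇒Real* : ∀ {L x ts} → Hung L x ts → Real* L ts
  Hung⇒Real* = All.map proj₂

  module _ {L M : Placement} (L⊑M : L ⊑ˡ M) where
    At-mono : ∀ {x P} → At L x P → At M x P
    At-mono (j , p , q) = j , L⊑M p , q

    Joined-mono : ∀ {x y} → Joined L x y → Joined M x y
    Joined-mono (j , l , p , q , e) = j , l , L⊑M p , L⊑M q , e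

    mutual
      Real-mono : ∀ {t} → Real L t → Real M t
      Real-mono (real p h) = real (At-mono p) (Hung-mono h)

      Hung-mono : ∀ {x ts} → Hung L x ts → Hung M x ts
      Hung-mono []            = []
      Hung-mono ((j , r) ∷ h) = (Joined-mono j , Real-mono r) ∷ Hung-mono h

    RealC-mono : ∀ K {x} → RealC L K x → RealC M K x
    RealC-mono []      _               = tt
    RealC-mono (_ ∷ K) (j , p , h , c) = Joined-mono j , At-mono p , Hung-mono h , RealC-mono K c

  hang : ∀ {L M x ts} → L ⊑ˡ M → (∀ {y} → Placed L y → Joined M x y) → Real* L ts → Hung M x ts
  hang L⊑M hub = All.map (λ r → hub (Real⇒Placed r) , Real-mono L⊑M r)

  Real-plug⁺ : ∀ {L} K {t} → Real L t → RealC L K (root t) → Real L (plug K t)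
  Real-plug⁺ []      r _               = r
  Real-plug⁺ (_ ∷ K) r (j , p , h , c) = Real-plug⁺ K (real p ((j , r) ∷ h)) c

  Real-plug⁻ : ∀ {L} K {t} → Real L (plug K t) → Real L t × RealC L K (root t)
  Real-plug⁻ []      r = r , tt
  Real-plug⁻ (_ ∷ K) r with Real-plug⁻ K r
  ... | real p ((j , r′) ∷ h) , c = r′ , j , p , h , c

  -- As `y` is adjacent to everything in `L`, it can fill the hole and take over the forest `us`,
  -- which had been hung one vertex higher to keep the remainder in one tree.
  Real-trim : ∀ {L M} → L ⊑ˡ M → ∀ K {us y} → (∀ {x} → Placed L x → Joined M y x) →
              Real* L (trim K us) → RealC M K y × Hung M y us
  Real-trim L⊑M []             hub rs       = tt , hang L⊑M hub rs
  Real-trim L⊑M ((x , ts) ∷ K) hub (r ∷ []) with Real-plug⁻ K r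
  ... | real p h , c = (Joined-sym (hub p) , At-mono L⊑M p , Hung-mono L⊑M (++⁻ˡ ts h) , RealC-mono L⊑M K c) ,
                       hang L⊑M hub (Hung⇒Real* (++⁻ʳ ts h))

  -- Adjacency is symmetric, so re-rooting a context at its lower end does not change its edges.
  Real-ups : ∀ {L} K {y} → Hung L y (ups K) → RealC L K y
  Real-ups []             h                     = tt
  Real-ups ((x , ts) ∷ K) ((j , real p h) ∷ []) = Joined-sym j , p , ++⁻ˡ ts h , Real-ups K (++⁻ʳ ts h)

  top : Address × Forest → Ctx → Address
  top (x , _) []      = x
  top _       (f ∷ K) = top f K

  root-plug : ∀ f K t → root (plug (f ∷ K) t) ≡ top f K
  root-plug f []      t = refl
  root-plug f (g ∷ K) t = root-plug g K _

  root-trim : ∀ K {x ts us} → root (plug K (node x us)) ≡ top (x , ts) K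
  root-trim []      = refl
  root-trim (f ∷ K) = root-plug f K _

  root-plug-any : ∀ K {x ts us} → root (plug K (node x ts)) ≡ root (plug K (node x us))
  root-plug-any []      = refl
  root-plug-any (f ∷ K) = trans (root-plug f K _) (sym (root-plug f K _))

  RealC-swap : ∀ {L M} → L ⊑ˡ M → ∀ K {x y} → (∀ {z} → Placed L z → Joined M y z) → RealC L K x → RealC M K y
  RealC-swap L⊑M []      hub _               = tt
  RealC-swap L⊑M (_ ∷ K) hub (_ , p , h , c) =
    Joined-sym (hub p) , At-mono L⊑M p , Hung-mono L⊑M h , RealC-mono L⊑M K c

  -- The deleted root of the context is adjacent to everything in `L`, so its edges come for free.
  Real-ups⁻ : ∀ {L M} → L ⊑ˡ M → ∀ f K {y} → Placed M (top f K) →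
              (∀ {x} → Placed L x → Joined M (top f K) x) →
              Placed L y → Hung L y (ups⁻ (f ∷ K)) → RealC M (f ∷ K) y
  Real-ups⁻ L⊑M (x , ts) []      p hub q h =
    hub q , p , All.map (λ (_ , r) → hub (Real⇒Placed r) , Real-mono L⊑M r) h , tt
  Real-ups⁻ L⊑M (x , ts) (g ∷ K) p hub q ((j , real r h) ∷ []) =
    Joined-mono L⊑M (Joined-sym j) , At-mono L⊑M r , Hung-mono L⊑M (++⁻ˡ ts h) ,
    Real-ups⁻ L⊑M g K p hub r (++⁻ʳ ts h)

  -- LG carries what has been cut off the branch C of p, LF the remainder of the tree.
  module Assemble {L LG LF : Placement} (subG : LG ⊑ˡ L) (subF : LF ⊑ˡ L)
                  (K : Ctx) (p : Address) (P : Forest) (Q : Forest) where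

    -- `y` is adjacent to both parts, so the forests below it and the part of `C` above it may be
    -- placed independently. The root of `C`, unless it is `y`, is joined to `p` inside `LF`.
    deep-ok : ∀ K′ y X Y → Placed L y → (∀ {x} → Placed LG x → Joined L y x) → (∀ {x} → Placed LF x → Joined L y x) →
              Hung L p P → Real* LG X → Real LF (plug K (node p (Q ++ trim K′ Y))) →
              Real L (plug K (node p (P ++ plug K′ (node y (X ++ Y)) ∷ Q)))
    deep-ok K′ y X Y y-at hubG hubF hungP okG okF with Real-plug⁻ K okF
    ... | real p-at h , c with Real-trim subF K′ hubF (Hung⇒Real* (++⁻ʳ Q h))
    ...   | c′ , hY = Real-plug⁺ K (real (At-mono subF p-at) (++⁺ hungP
              ((to-root K′ (++⁻ʳ Q h) , Real-plug⁺ K′ (real y-at (++⁺ (hang subG hubG okG) hY)) c′) ∷ Hung-mono subF (++⁻ˡ Q h))))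
              (RealC-mono subF K c)
      where
      to-root : ∀ K″ → Hung LF p (trim K″ Y) → Joined L p (root (plug K″ (node y (X ++ Y))))
      to-root []              _              = Joined-sym (hubF p-at)
      to-root ((x , ts) ∷ K″) ((j , _) ∷ []) = subst (Joined L p)
        (trans (root-trim K″) (sym (root-plug (x , ts) K″ _))) (Joined-mono subF j)

    -- Apart from the edges at `q`, which is adjacent to both parts, the edge from `p` to the root
    -- of `C` is the only one between `LF` and `LG`; hence the hypothesis on `top`. For an empty
    -- context that root is `q`.
    wide-ok : ∀ K′ q h X Y → Placed L q → (∀ {x} → Placed LG x → Joined L q x) → (∀ {x} → Placed LF x → Joined L q x) →
              Hung L p P → (∀ f K″ → K′ ≡ f ∷ K″ → Joined L p (top f K″)) →
              Real* LG (trim K′ X) → Real LF (plug K (node p (Q ++ h ∷ Y))) →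
              Real L (plug K (node p (P ++ plug K′ (node q (h ∷ X ++ Y)) ∷ Q)))
    wide-ok K′ q h X Y q-at hubG hubF hungP p–top okG okF with Real-plug⁻ K okF | Real-trim subG K′ hubG okG
    ... | real p-at hh , c | c′ , hX with hang subF hubF (Hung⇒Real* (++⁻ʳ Q hh))
    ...   | hu ∷ hY = Real-plug⁺ K (real (At-mono subF p-at) (++⁺ hungP
              ((to-root K′ refl , Real-plug⁺ K′ (real q-at (hu ∷ ++⁺ hX hY)) c′) ∷ Hung-mono subF (++⁻ˡ Q hh))))
              (RealC-mono subF K c)
      where
      to-root : ∀ K″ → K′ ≡ K″ → Joined L p (root (plug K″ (node q (h ∷ X ++ Y))))
      to-root []       _ = Joined-sym (hubF p-at)
      to-root (f ∷ K″) e = subst (Joined L p) (sym (root-plug f K″ _)) (p–top f K″ e)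

    -- Here `p` is adjacent to both parts, and `r`, the lower end of the cut edge, takes its place
    -- in the remainder; the upper part of `C` is re-rooted at `q`. Only the edge from `q` to `r`
    -- joins the two parts.
    edge-ok : ∀ K′ q r hs ts → Placed L p → (∀ {x} → Placed LG x → Joined L p x) → (∀ {x} → Placed LF x → Joined L p x) →
              Hung L p P → Joined L q r → Real LG (node q (ts ++ ups K′)) → Real LF (plug K (node r (Q ++ hs))) →
              Real L (plug K (node p (P ++ plug K′ (node q (node r hs ∷ ts)) ∷ Q)))
    edge-ok K′ q r hs ts p-at hubG hubF hungP q–r (real q-at h) okF with Real-plug⁻ K okF
    ... | real r-at hh , c = Real-plug⁺ K (real p-at (++⁺ hungP
            ((hubG (subst (Placed LG) (root-plug-any K′) (Real⇒Placed (Real-plug⁺ K′ (real q-at hts) c′))) ,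
              Real-plug⁺ K′ (real (At-mono subG q-at)
                ((q–r , real (At-mono subF r-at) (Hung-mono subF (++⁻ʳ Q hh))) ∷ Hung-mono subG hts))
                (RealC-mono subG K′ c′))
             ∷ hang subF hubF (Hung⇒Real* (++⁻ˡ Q hh)))))
            (RealC-swap subF K hubF c)
      where
      hts : Hung LG q ts
      hts = ++⁻ˡ ts h
      c′ : RealC LG K′ q
      c′ = Real-ups K′ (++⁻ʳ ts h)

  mutual
    Real-sort⁻ : ∀ {L} t → Real L (sort t) → Real L t
    Real-sort⁻ (node x ts) (real p h) = real p (Hung-sort ts h)

    Hung-sort : ∀ {L x} ts → Hung L x (sort* ts) → Hung L x ts
    Hung-sort []       h = []
    Hung-sort (t ∷ ts) h with All-insert⁻ (sort t) (sort* ts) h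
    ... | (j , r) ∷ h′ = (subst (Joined _ _) (root-sort t) j , Real-sort⁻ t r) ∷ Hung-sort ts h′

-- The embedding

-- What the proof uses of the vertices 0 , … , n − 1 of the host tree in preorder. Next i u v says that
-- u is the nearest left cousin of v, of level i; count i u v is then ν(u), and two-left, quarter, deeper
-- and fertile are T1–T4.
record Host : Set₁ where
  field
    n        : ℕ
    lev      : ℕ → ℕ
    _~_      : ℕ → ℕ → Set
    ~-sym    : ∀ {x y} → x ~ y → y ~ x
    lev-step : ∀ x → suc x < n → lev (suc x) ≤ suc (lev x)

  open Levels lev public

  Next : ℕ → ℕ → ℕ → Set
  Next i u v = u < v × lev u ≡ i × NoLev i (suc u) v

  field
    hub : ∀ {i a v k x} → k ≤ n → Pinched i a k → a ≤ v → v < k → lev v ≡ i → NoLev i (suc v) k →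
          a ≤ x → x < k → i ≤ lev x → x ≢ v → v ~ x
    clique : ∀ {i a k x y} → k ≤ n → Pinched i a k → a ≤ x → x < k → a ≤ y → y < k →
             i ≤ lev x → lev x ≤ suc i → i ≤ lev y → lev y ≤ suc i → x ≢ y → x ~ y
    two-left : ∀ {i v″ v′ v k} → Next i v″ v′ → Next i v′ v → lev v ≡ i → v < k → k ≤ n → NoLev i (suc v) k →
               count i v k ≤ count i v′ v + count i v″ v′
    quarter : ∀ {i v′ v k} → Next i v′ v → lev v ≡ i → v < k → k ≤ n → NoLev i (suc v) k →
              count i v k ≤ 4 * count i v′ v
    deeper : ∀ {i v′ v w k} → Next i v′ v → lev v ≡ i → v < n → lev w ≡ suc i → w < k → k ≤ n →
             NoLev (suc i) (suc w) k → count (suc i) w k ≤ count i v′ v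
    fertile : ∀ {i v′ v k} → Next i v′ v → lev v ≡ i → v < k → k ≤ n → NoLev i (suc v) k →
              1 ≤ count (suc i) v k → 2 ≤ count i v′ v

length-zero : ∀ {X : Set} {xs : List X} → 0 ≡ length xs → xs ≡ []
length-zero {xs = []} _ = refl

-- Equations and bounds for the sizes of the parts

cancel-fin : ∀ {r q c y rq s} → rq ≡ r + q → s ≡ suc q + y → suc rq + c ≡ s → r + c ≡ y
cancel-fin {r} {q} {c} {y} refl refl e = +-cancelˡ-≡ (suc q) (r + c) y (trans (lemma q r c) e)
  where
  lemma : ∀ q r c → suc q + (r + c) ≡ suc (r + q) + c
  lemma = solve-∀

cancel-up : ∀ {p q u c s y} → p ≡ q + u → suc u ≡ c → suc y ≡ s → suc q + c ≡ s → suc p ≡ y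
cancel-up {q = q} {u} refl refl refl e = suc-injective (trans (cong suc (sym (+-suc q u))) e)

cancel-cl : ∀ {x r c y s F} → F ≡ suc (x + r) + c → F ≡ s → s ≡ suc x + y → r + c ≡ y
cancel-cl {x} {r} {c} {y} refl refl e = +-cancelˡ-≡ (suc x) (r + c) y (trans (sym (+-assoc (suc x) r c)) e)

fin-size : ∀ {s c r κ f q x F G} → F ≡ suc (s + (c + r)) + κ → c ≡ suc (f + q) → F ≡ suc (s + f) + x →
           G ≡ suc (r + q) + κ → G ≡ x
fin-size {s} {r = r} {κ} {f} {q} {x} e refl refl refl = +-cancelˡ-≡ (suc (s + f)) (suc (r + q) + κ) x
  (trans (eq s r κ f q) (sym e))
  where
  eq : ∀ s r κ f q → suc (s + f) + (suc (r + q) + κ) ≡ suc (s + (suc (f + q) + r)) + κ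
  eq = solve-∀

fin-less : ∀ {s c r κ f q F G} → F ≡ suc (s + (c + r)) + κ → c ≡ suc (f + q) → G ≡ suc (r + q) + κ → G < F
fin-less {s} {r = r} {κ} {f} {q} refl refl refl = ≤-trans (m≤n+m _ (s + f)) (≤-reflexive (eq s r κ f q))
  where
  eq : ∀ s r κ f q → s + f + suc (suc (r + q) + κ) ≡ suc (s + (suc (f + q) + r)) + κ
  eq = solve-∀

group-less : ∀ {s c r κ f q F} → F ≡ suc (s + (c + r)) + κ → c ≡ suc (f + q) → f < F
group-less {s} {r = r} {κ} {f} {q} refl refl = ≤-trans (m≤m+n _ (s + q + r + κ + 1)) (≤-reflexive (eq s r κ f q))
  where
  eq : ∀ s r κ f q → suc f + (s + q + r + κ + 1) ≡ suc (s + (suc (f + q) + r)) + κ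
  eq = solve-∀

pre-less : ∀ {s c r κ F} → F ≡ suc (s + (c + r)) + κ → s < F
pre-less {s} {c} {r} {κ} refl = ≤-trans (s≤s (m≤m+n s (c + r))) (m≤m+n _ κ)

fin-lower : ∀ {N l c f q t} → N + l ≤ c → c ≡ suc (f + q) → suc (f + t) ≡ N + l → t ≤ q
fin-lower {f = f} {q} {t} h refl e = +-cancelˡ-≤ f t q (≤-pred (≤-trans (≤-reflexive e) h))

-- T1 enters as `B < l + μ`: what is left of the branch is bounded by the `t` places below `v′` and
-- the `μ` vertices of the subtree of `v″`.
fin-upper : ∀ {N l c f q t B μ} → c ≤ B → suc B ≤ l + μ → c ≡ suc (f + q) → suc (f + t) ≡ N + l → q < t + μ
fin-upper {N} {l} {_} {f} {q} {t} {B} {μ} h₁ h₂ refl e =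
  farkas N (+-mono-≤ h₁ (+-mono-≤ h₂ (≤-reflexive (sym e)))) (eq N l f q t B μ)
  where
  eq : ∀ N l f q t B μ → suc q + (B + (l + μ + suc (f + t))) + N ≡ t + μ + (suc (f + q) + (suc B + (N + l)))
  eq = solve-∀

shuffle : ∀ h x y κ → h + (x + y) + κ ≡ x + κ + (h + y)
shuffle = solve-∀

shuffle′ : ∀ h t κ → suc (suc h + t) + κ ≡ suc (suc (t + κ) + h)
shuffle′ = solve-∀

module Embed (H : Host) where
  open Host H
  open Trees
  open Realise _~_ ~-sym
  open Cuts

  -- Levels increase by at most one from a vertex to the next in preorder, so none is skipped on the
  -- way up.
  rise : ∀ {i y x} → y < x → x < n → lev y ≤ i → i < lev x → ∃ λ w → y < w × w ≤ x × lev w ≡ suc i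
  rise {i} {y} {suc x} (s≤s y≤x) x<n ly lx with lev x ≤? i
  ... | yes p = suc x , s≤s y≤x , ≤-refl , ≤-antisym (≤-trans (lev-step x x<n) (s≤s p)) lx
  ... | no ¬p with m≤n⇒m<n∨m≡n y≤x
  ...   | inj₂ refl = contradiction ly ¬p
  ...   | inj₁ y<x = let (w , p , q , r) = rise y<x (<-trans (n<1+n x) x<n) ly (≰⇒> ¬p) in w , p , m≤n⇒m≤1+n q , r

  child-at : ∀ {i v k} → k ≤ n → lev v ≡ i → 1 ≤ count (suc i) v k →
             ∃ λ w → v < w × w < k × lev w ≡ suc i
  child-at {i} {v} {k} k≤n refl c with count-pos⁻ (suc i) v k c
  ... | x , v≤x , x<k , lx = let (w , p , q , r) = rise v<x (<-≤-trans x<k k≤n) ≤-refl lx in w , p , ≤-<-trans q x<k , r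
    where v<x = ≤∧≢⇒< v≤x (λ { refl → <-irrefl refl lx })

  HasLev : ℕ → ℕ → ℕ → Set
  HasLev i a k = ∃ λ v → a ≤ v × v < k × lev v ≡ i

  -- The last field is conditional because the induction also passes through intervals without
  -- vertices of level `i`.
  record Emb (i a k : ℕ) (t : LTree) : Set where
    constructor emb
    field
      place : Placement
      onto  : map proj₂ place ↭ Il i a k
      ok    : Real place t
      high  : HasLev i a k → At place (root t) (λ j → lev j ≡ i)

  record Emb* (i a k : ℕ) (ts : Forest) : Set where
    constructor emb*
    field
      place : Placement
      onto  : map proj₂ place ↭ Il i a k
      ok    : Real* place ts

  where-is : ∀ {L i a k x P} → map proj₂ L ↭ Il i a k → At L x P → At L x (λ j → P j × a ≤ j × j < k × i ≤ lev j)
  where-is {i = i} {a} {k} onto (j , p , q) = j , p , q , ∈-Il⁻ i a k (∈-resp-↭ onto (∈-map⁺ proj₂ p))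

  Hyp : ℕ → Set
  Hyp m = ∀ {i a k} t → ⟨ t ⟩ < m → k ≤ n → Pinched i a k → ⟨ t ⟩ ≡ count i a k → Emb i a k t

  module Step (m : ℕ) (IH : Hyp m) where

    -- Hang the other trees on the root of the first, place the single tree so obtained, and forget
    -- the added edges.
    IH* : ∀ {i a k} ts → ⟪ ts ⟫ < m → k ≤ n → Pinched i a k → ⟪ ts ⟫ ≡ count i a k → Emb* i a k ts
    IH* [] _ _ _ e = emb* [] (↭-reflexive (sym (length-zero e))) []
    IH* (node x us ∷ ts) lt k≤n w e
      with IH (node x (us ++ ts)) (subst (_< m) (sym eq) lt) k≤n w (trans eq e)
      where
      eq : suc ⟪ us ++ ts ⟫ ≡ suc (⟪ us ⟫ + ⟪ ts ⟫)
      eq = cong suc (⟪++⟫ us ts)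
    ... | emb L onto (real p h) _ = emb* L onto (real p (++⁻ˡ us h) ∷ Hung⇒Real* (++⁻ʳ us h))

    -- c sits on v, the last vertex of level i in [a , k); the vertices of [b , k) of higher level
    -- carry L₁ and those of [a , b) carry L₂.
    record Star (i a b k : ℕ) (c : Address) (L₁ L₂ : Placement) : Set where
      constructor star
      field
        M        : Placement
        onto     : map proj₂ M ↭ Il i a k
        sub₁     : L₁ ⊑ˡ M
        sub₂     : L₂ ⊑ˡ M
        c-at     : At M c (λ j → lev j ≡ i)
        hub₁     : ∀ {x} → Placed L₁ x → Joined M c x
        hub₂     : ∀ {x} → Placed L₂ x → Joined M c x
        clique₁₂ : ∀ {x y} → At L₁ x (λ j → lev j ≡ suc i) → At L₂ y (λ j → lev j ≤ suc i) → Joined M x y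

    -- `v` is the only vertex of level `i` in `[b , k)`, so `v` and the sets under `L₁` and `L₂`
    -- make up the whole. The adjacencies of `c` are G1-G3 at `v`; those between `L₁` and `L₂` come
    -- from the clique on levels `i` and `i + 1`.
    centre : ∀ {i a k v b} → k ≤ n → Pinched i a k → a ≤ b → b ≤ v → v < k →
             lev v ≡ i → NoLev i b v → NoLev i (suc v) k → ∀ c L₁ L₂ →
             map proj₂ L₁ ↭ Il (suc i) b k → map proj₂ L₂ ↭ Il i a b → Star i a b k c L₁ L₂
    centre {i} {a} {k} {v} {b} k≤n w a≤b b≤v v<k lv nl₁ nl₂ c L₁ L₂ onto₁ onto₂ =
      star ((c , v) ∷ L₁ ++ L₂) onto sub₁ sub₂ (v , here refl , lv) hub₁ hub₂ clique₁₂
      where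
      onto : v ∷ map proj₂ (L₁ ++ L₂) ↭ Il i a k
      onto = ↭-trans (prep v (↭-trans (↭-reflexive (map-++ proj₂ L₁ L₂)) (↭-++⁺ onto₁ onto₂)))
               (↭-trans (↭-++⁺ (↭-sym (Il-hole i b≤v v<k lv nl₁ nl₂)) ↭-refl)
                 (↭-reflexive (sym (Il-split i a≤b (≤-trans b≤v (<⇒≤ v<k))))))

      sub₁ : L₁ ⊑ˡ (c , v) ∷ L₁ ++ L₂
      sub₁ p = there (∈-++⁺ˡ p)

      sub₂ : L₂ ⊑ˡ (c , v) ∷ L₁ ++ L₂
      sub₂ p = there (∈-++⁺ʳ L₁ p)

      hub₁ : ∀ {x} → Placed L₁ x → Joined ((c , v) ∷ L₁ ++ L₂) c x
      hub₁ p with where-is onto₁ p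
      ... | j , q , _ , b≤j , j<k , lj = v , j , here refl , sub₁ q ,
        hub k≤n w (≤-trans a≤b b≤v) v<k lv nl₂ (≤-trans a≤b b≤j) j<k (<⇒≤ lj) (λ { refl → <-irrefl (sym lv) lj })

      hub₂ : ∀ {x} → Placed L₂ x → Joined ((c , v) ∷ L₁ ++ L₂) c x
      hub₂ p with where-is onto₂ p
      ... | j , q , _ , a≤j , j<b , lj = v , j , here refl , sub₂ q ,
        hub k≤n w (≤-trans a≤b b≤v) v<k lv nl₂ a≤j (<-trans (<-≤-trans j<b b≤v) v<k) lj (<⇒≢ (<-≤-trans j<b b≤v))

      clique₁₂ : ∀ {x y} → At L₁ x (λ j → lev j ≡ suc i) → At L₂ y (λ j → lev j ≤ suc i) →
                 Joined ((c , v) ∷ L₁ ++ L₂) x y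
      clique₁₂ p q with where-is onto₁ p | where-is onto₂ q
      ... | j , r , lj , b≤j , j<k , _ | l , s , ll , a≤l , l<b , i≤ll =
        j , l , sub₁ r , sub₂ s ,
        clique k≤n w (≤-trans a≤b b≤j) j<k a≤l (<-trans (<-≤-trans l<b b≤v) v<k)
          (≤-trans (n≤1+n i) (≤-reflexive (sym lj))) (≤-reflexive lj) i≤ll ll (>⇒≢ (<-≤-trans l<b b≤j))

    RootAt : ℕ → Placement → Ctx → Set
    RootAt i L []      = ⊤
    RootAt i L (f ∷ K) = At L (top f K) (λ j → lev j ≡ i)

    -- For an empty context the trimmed part is a bare forest without a root to control; hence the
    -- case distinction in `RootAt`.
    place-trim : ∀ {i a k} K us → ⟪ us ⟫ + ⟦ K ⟧ < m → k ≤ n → Pinched i a k → HasLev i a k →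
                 ⟪ us ⟫ + ⟦ K ⟧ ≡ count i a k →
                 ∃ λ L → map proj₂ L ↭ Il i a k × Real* L (trim K us) × RootAt i L K
    place-trim [] us lt k≤n w hl sz
      with IH* us (subst (_< m) (+-identityʳ _) lt) k≤n w (trans (sym (+-identityʳ _)) sz)
    ... | emb* L onto ok = L , onto , ok , tt
    place-trim {i} K@((x , ts) ∷ K′) us lt k≤n w hl sz
      with IH (plug K′ (node x (ts ++ us))) (subst (_< m) (sym eq) lt) k≤n w (trans eq sz)
      where
      eq : ⟨ plug K′ (node x (ts ++ us)) ⟩ ≡ ⟪ us ⟫ + ⟦ K ⟧
      eq = trans (sym (+-identityʳ _)) (⟪trim⟫ K us)
    ... | emb L onto ok high = L , onto , ok ∷ [] , subst (λ r → At L r (λ j → lev j ≡ i)) (root-trim K′) (high hl)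

    RootAt⇒At : ∀ {i L M} → L ⊑ˡ M → ∀ K {p ts} → RootAt i L K → At M p (λ j → lev j ≡ i) →
                At M (root (plug K (node p ts))) (λ j → lev j ≡ i)
    RootAt⇒At L⊑M []      _ q = q
    RootAt⇒At {i} {M = M} L⊑M (f ∷ K) r _ = subst (λ x → At M x (λ j → lev j ≡ i)) (sym (root-plug f K _)) (At-mono L⊑M r)

    -- `g` is kept on the two levels that form a clique, so that it can be joined to vertices placed
    -- outside this part.
    Remainder : (i a b : ℕ) → LTree → Address → Set
    Remainder i a b t g = ∃ λ L → map proj₂ L ↭ Il i a b × Real L t ×
      At L (root t) (λ j → lev j ≡ i) × At L g (λ j → lev j ≤ suc i)

    -- Put `g` on `v′`, where it is adjacent to everything, its branches `Qs` on the higher levels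
    -- of `[b₂ , b)`, and the rest on `[a , b₂)`, which still has a vertex of level `i` for the
    -- root.
    fin-sibling : ∀ {i a b₂ b v′} f K′ g Rs Qs → let K = f ∷ K′ in
          b ≤ n → Pinched i a b → v′ < b → lev v′ ≡ i → NoLev i b₂ v′ → NoLev i (suc v′) b →
          a ≤ b₂ → b₂ ≤ v′ → count (suc i) b₂ b ≡ ⟪ Qs ⟫ → HasLev i a b₂ →
          ⟨ plug K (node g (Rs ++ Qs)) ⟩ ≡ count i a b → ⟨ plug K (node g (Rs ++ Qs)) ⟩ < m →
          Remainder i a b (plug K (node g (Rs ++ Qs))) g
    fin-sibling {i} {a} {b₂} {b} {v′} f K′ g Rs Qs b≤n w v′<b lv′ nl-b₂ nl a≤b₂ b₂≤v′ cnt has sz lt = done E₁ E₂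
      where
      K : Ctx
      K = f ∷ K′
      eqn : ⟪ Rs ⟫ + ⟦ K ⟧ ≡ count i a b₂
      eqn = cancel-fin (⟪++⟫ Rs Qs)
        (trans (count-split i a≤b₂ (≤-trans b₂≤v′ (<⇒≤ v′<b)))
          (cong (_+ count i a b₂) (trans (count-hole i b₂≤v′ v′<b lv′ nl-b₂ nl) (cong suc cnt))))
        (trans (sym (⟨plug⟩ K (node g (Rs ++ Qs)))) sz)
      total : ⟪ Qs ⟫ + suc (⟪ Rs ⟫ + ⟦ K ⟧) ≡ ⟨ plug K (node g (Rs ++ Qs)) ⟩
      total = sym (trans (⟨plug⟩ K (node g (Rs ++ Qs))) (trans (cong (λ s → suc s + ⟦ K ⟧)
                (trans (⟪++⟫ Rs Qs) (+-comm ⟪ Rs ⟫ ⟪ Qs ⟫))) (suc-swap ⟪ Qs ⟫ ⟪ Rs ⟫ ⟦ K ⟧)))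
      E₁ : Emb* (suc i) b₂ b Qs
      E₁ = IH* Qs (≤-<-trans (≤-trans (m≤m+n _ _) (≤-reflexive total)) lt) b≤n
             (Pinched-hole nl-b₂ nl) (sym cnt)
      E₂ : ∃ λ L → map proj₂ L ↭ Il i a b₂ × Real* L (trim K Rs) × RootAt i L K
      E₂ = place-trim K Rs
             (≤-<-trans (≤-trans (n≤1+n _) (≤-trans (m≤n+m _ ⟪ Qs ⟫) (≤-reflexive total))) lt)
             (≤-trans b₂≤v′ (≤-trans (<⇒≤ v′<b) b≤n)) (Pinched-sub ≤-refl (≤-trans b₂≤v′ (<⇒≤ v′<b)) w)
             has eqn
      done : Emb* (suc i) b₂ b Qs → (∃ λ L → map proj₂ L ↭ Il i a b₂ × Real* L (trim K Rs) × RootAt i L K) →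
             Remainder i a b (plug K (node g (Rs ++ Qs))) g
      done (emb* L₁ onto₁ ok₁) (L₂ , onto₂ , ok₂ , root₂)
        with centre b≤n w a≤b₂ b₂≤v′ v′<b lv′ nl-b₂ nl g L₁ L₂ onto₁ onto₂
      ... | star L onto sub₁ sub₂ (j , g∈ , lj) hub₁ hub₂ _ = L , onto ,
        Real-plug⁺ K (real (j , g∈ , tt) (++⁺ (proj₂ parts) (hang sub₁ hub₁ ok₁))) (proj₁ parts) ,
        RootAt⇒At sub₂ K {ts = Rs ++ Qs} root₂ (j , g∈ , lj) ,
        (j , g∈ , ≤-trans (≤-reflexive lj) (n≤1+n i))
        where
        parts : RealC L K g × Hung L g Rs
        parts = Real-trim sub₂ K hub₂ ok₂

    -- The single vertex `v′` of level `i` must carry the root. Delete the root, re-root what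
    -- remains at `g` and apply induction one level higher, which puts `g` on level `i + 1`; on `v′`
    -- the root is adjacent to everything and can be put back.
    fin-alone : ∀ {i a b v′} f K′ g Qs → let K = f ∷ K′ in
          b ≤ n → Pinched i a b → a ≤ v′ → v′ < b → lev v′ ≡ i → NoLev i a v′ → NoLev i (suc v′) b →
          1 ≤ count (suc i) v′ b →
          ⟨ plug K (node g Qs) ⟩ ≡ count i a b → ⟨ plug K (node g Qs) ⟩ < m →
          Remainder i a b (plug K (node g Qs)) g
    fin-alone {i} {a} {b} {v′} f K′ g Qs b≤n w a≤v′ v′<b lv′ nl″ nl below sz lt =
      done (IH t′ (<-trans (≤-reflexive (trans (cong suc sz′) (trans (sym cnt) (sym sz)))) lt) b≤n (Pinched-hole nl″ nl) sz′)
      where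
      K : Ctx
      K = f ∷ K′
      t′ : LTree
      t′ = node g (Qs ++ ups⁻ K)
      cnt : count i a b ≡ suc (count (suc i) a b)
      cnt = count-hole i a≤v′ v′<b lv′ nl″ nl
      sz′ : ⟨ t′ ⟩ ≡ count (suc i) a b
      sz′ = cancel-up (⟪++⟫ Qs (ups⁻ K)) (⟪ups⁻⟫ f K′) (sym cnt) (trans (sym (⟨plug⟩ K (node g Qs))) sz)
      done : Emb (suc i) a b t′ → Remainder i a b (plug K (node g Qs)) g
      done (emb L₁ onto₁ (real p h) high₁)
        with centre b≤n w ≤-refl a≤v′ v′<b lv′ nl″ nl (top f K′) L₁ [] onto₁ (↭-reflexive (sym (Il-empty i a a ≤-refl)))
           | high₁ (let (c , p , q , r) = child-at b≤n lv′ below in c , ≤-trans a≤v′ (<⇒≤ p) , q , r)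
      ... | star L onto sub₁ sub₂ (j , z∈ , lj) hub₁ hub₂ _ | l , g∈ , ll = L , onto ,
        Real-plug⁺ K (real (At-mono sub₁ p) (Hung-mono sub₁ (++⁻ˡ Qs h)))
          (Real-ups⁻ sub₁ f K′ (j , z∈ , tt) hub₁ p (++⁻ʳ Qs h)) ,
        subst (λ r → At L r (λ j → lev j ≡ i)) (sym (root-plug f K′ (node g Qs))) (j , z∈ , lj) ,
        (l , sub₁ g∈ , ≤-reflexive ll)

    -- Three cases: `g` is the root; `v′` is alone on level `i`; or a cousin `v″` precedes it. In
    -- the last, the bounds on `Qs` make the cut fall between `v″` and `v′`, so that each side has
    -- its vertex of level `i`.
    fin : ∀ {i a b v′} K g Rs Qs → b ≤ n → Pinched i a b → a ≤ v′ → v′ < b → lev v′ ≡ i → NoLev i (suc v′) b →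
          1 ≤ count (suc i) v′ b →
          (∀ {v″} → a ≤ v″ → Next i v″ v′ →
            count (suc i) v′ b ≤ ⟪ Qs ⟫ × ⟪ Qs ⟫ < count (suc i) v′ b + count i v″ v′) →
          ⟨ plug K (node g (Rs ++ Qs)) ⟩ ≡ count i a b → ⟨ plug K (node g (Rs ++ Qs)) ⟩ < m →
          Remainder i a b (plug K (node g (Rs ++ Qs))) g
    fin {i} [] g Rs Qs b≤n w a≤v′ v′<b lv′ nl below bound sz lt
      with IH (node g (Rs ++ Qs)) lt b≤n w sz
    ... | emb L onto ok high = let (j , p , q) = high (_ , a≤v′ , v′<b , lv′) in
            L , onto , ok , (j , p , q) , (j , p , ≤-trans (≤-reflexive q) (n≤1+n i))
    fin {i} {a} {b} {v′} (f ∷ K′) g Rs Qs b≤n w a≤v′ v′<b lv′ nl below bound sz lt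
      with last-lev i a v′
    ... | inj₂ nl″ = fin-alone f K′ g (Rs ++ Qs) b≤n w a≤v′ v′<b lv′ nl″ nl below sz lt
    ... | inj₁ (v″ , a≤v″ , v″<v′ , lv″ , nl″)
      with cut-at (suc i) {suc v″} {v′} b ⟪ Qs ⟫ v″<v′ (proj₁ (bound a≤v″ (v″<v′ , lv″ , nl″)))
             (≤-pred (≤-trans (proj₂ (bound a≤v″ (v″<v′ , lv″ , nl″)))
               (≤-reflexive (trans (cong (count (suc i) v′ b +_) (count-first i v″<v′ lv″ nl″))
                 (trans (+-suc _ _) (cong suc (sym (count-split (suc i) v″<v′ (<⇒≤ v′<b)))))))))
    ... | b₂ , v″<b₂ , b₂≤v′ , cnt = fin-sibling f K′ g Rs Qs b≤n w v′<b lv′ (NoLev-sub v″<b₂ ≤-refl nl″) nl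
            (≤-trans a≤v″ (<⇒≤ v″<b₂)) b₂≤v′ cnt (v″ , a≤v″ , v″<b₂ , lv″) sz lt

    -- The trees are laid out from the right end. By T3 the subtree of a vertex of level `i + 1` has
    -- at most as many vertices as that of `v′`. Each tree has at least as many, so the piece cut
    -- out for it reaches back to a vertex of that level, which can carry its root.
    place-all : ∀ {i v′ v b k} ts → Next i v′ v → lev v ≡ i → v < b → b ≤ k → k ≤ n → NoLev i (suc v) k →
                All (λ t → count i v′ v ≤ ⟨ t ⟩) ts → ⟪ ts ⟫ < m → ⟪ ts ⟫ ≡ count (suc i) b k →
                ∃ λ L → map proj₂ L ↭ Il (suc i) b k × All (λ t → At L (root t) (λ j → lev j ≡ suc i) × Real L t) ts
    place-all [] nx lv v<b b≤k k≤n nl bigs lt sz = [] , ↭-reflexive (sym (length-zero sz)) , []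
    place-all {i} {v′} {v} {b} {k} (t ∷ ts) nx lv v<b b≤k k≤n nl (big ∷ bigs) lt sz
      with cut-at (suc i) {b} {k} k ⟨ t ⟩ b≤k (≤-trans (≤-reflexive (count-empty (suc i) k)) z≤n)
             (≤-trans (m≤m+n _ _) (≤-reflexive sz))
    ... | b₁ , b≤b₁ , b₁≤k , cnt
      with IH t (≤-<-trans (m≤m+n _ _) lt) k≤n (Pinched-none (NoLev-sub (≤-trans v<b b≤b₁) ≤-refl nl)) (sym cnt)
         | place-all ts nx lv v<b b≤b₁ (≤-trans b₁≤k k≤n) (NoLev-sub ≤-refl b₁≤k nl) bigs (≤-<-trans (m≤n+m _ _) lt)
             (+-cancelˡ-≡ ⟨ t ⟩ _ _ (trans sz (trans (count-split (suc i) b≤b₁ b₁≤k) (cong (_+ count (suc i) b b₁) cnt))))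
    ... | emb L₁ onto₁ ok₁ high₁ | L₂ , onto₂ , ok₂ =
      L₁ ++ L₂ ,
      ↭-trans (↭-reflexive (map-++ proj₂ L₁ L₂)) (↭-trans (↭-++⁺ onto₁ onto₂) (↭-reflexive (sym (Il-split (suc i) b≤b₁ b₁≤k)))) ,
      (At-mono ∈-++⁺ˡ (high₁ has-lev) , Real-mono ∈-++⁺ˡ ok₁) ∷
      All.map (λ (p , r) → At-mono (∈-++⁺ʳ L₁) p , Real-mono (∈-++⁺ʳ L₁) r) ok₂
      where
      has-lev : HasLev (suc i) b₁ k
      has-lev with last-lev (suc i) b₁ k
      ... | inj₁ (w , p , q , r , _) = w , p , q , r
      ... | inj₂ none with last-lev (suc i) (suc v) k
      ...   | inj₂ none′ =
        let (w , p , q , r) = child-at k≤n lv (≤-trans (⟨t⟩>0 t) (≤-trans (≤-reflexive (sym cnt))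
              (≤-trans (m≤m+n _ _) (≤-reflexive (sym (count-split (suc i) (≤-trans (<⇒≤ v<b) b≤b₁) b₁≤k))))))
        in contradiction r (none′ w p q)
      ...   | inj₁ (w , v<w , w<k , lw , nlw) with b₁ ≤? w
      ...     | yes b₁≤w = contradiction lw (none w b₁≤w w<k)
      ...     | no b₁≰w = contradiction
        (≤-trans (≤-reflexive (sym (count-split (suc i) (<⇒≤ w<b₁) b₁≤k)))
          (≤-trans (deeper nx lv (<-≤-trans v<b (≤-trans b≤k k≤n)) lw w<k k≤n nlw) (≤-trans big (≤-reflexive (sym cnt)))))
        (<⇒≱ (m<m+n (count (suc i) b₁ k) (∈-length (∈-Il⁺ (suc i) w b₁ ≤-refl w<b₁ (≤-reflexive (sym lw))))))
        where w<b₁ = ≰⇒> b₁≰w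

    -- The induction step when level `i` has at least two vertices

    module TwoLeft {i a k v v′ : ℕ} (k≤n : k ≤ n) (w : Pinched i a k) (a≤v′ : a ≤ v′) (nx : Next i v′ v)
                   (v<k : v < k) (lv : lev v ≡ i) (nl : NoLev i (suc v) k) where

      v′<v : v′ < v
      v′<v = proj₁ nx

      lv′ : lev v′ ≡ i
      lv′ = proj₁ (proj₂ nx)

      nl′ : NoLev i (suc v′) v
      nl′ = proj₂ (proj₂ nx)

      l : ℕ
      l = count i v′ v

      total : ∀ {e} → v < e → count (suc i) v e + l ≡ suc (count (suc i) (suc v′) e)
      total {e} v<e = trans (cong (count (suc i) v e +_) (count-first i v′<v lv′ nl′))
        (trans (+-suc _ _) (cong suc (sym (count-split (suc i) v′<v (<⇒≤ v<e)))))

      -- Before `e` there are `count (suc i) v e` vertices below `v`, and `l − 1` below `v′`, so the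
      -- size `f` is attained with `b` after `v′`. The last component records the places left below
      -- `v′`.
      split-at : ∀ {e} f → v < e → count (suc i) v e ≤ f → f < count (suc i) v e + l →
                 ∃ λ b → v′ < b × b ≤ v × count (suc i) b e ≡ f ×
                   suc (f + count (suc i) v′ b) ≡ count (suc i) v e + l
      split-at {e} f v<e lo hi
        with cut-at (suc i) {suc v′} {v} e f v′<v lo (≤-pred (≤-trans hi (≤-reflexive (total v<e))))
      ... | b , v′<b , b≤v , cnt = b , v′<b , b≤v , cnt ,
        trans (cong suc (trans (cong₂ _+_ (sym cnt) (sym (count-above i {v′} {b} lv′)))
          (sym (count-split (suc i) v′<b (≤-trans b≤v (<⇒≤ v<e)))))) (sym (total v<e))

      -- The branches `P` and `C` fit: `p` goes on `v`, they go on the higher levels of `[b , k)`,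
      -- and all else goes on `[a , b)`.
      centre-case : ∀ K p P C Q → ⟨ plug K (node p (P ++ C ∷ Q)) ⟩ ≡ m →
                    ⟨ plug K (node p (P ++ C ∷ Q)) ⟩ ≡ count i a k →
                    count (suc i) v k ≤ ⟪ P ⟫ + ⟨ C ⟩ → ⟪ P ⟫ + ⟨ C ⟩ < count (suc i) v k + l →
                    Emb i a k (plug K (node p (P ++ C ∷ Q)))
      centre-case K p P C Q szm sz lo hi with split-at (⟪ P ⟫ + ⟨ C ⟩) v<k lo hi
      ... | b , v′<b , b≤v , cnt , _ = done
          (IH* (P ++ [ C ]) ltX k≤n (Pinched-hole nl-b nl) (trans szX (sym cnt)))
          (place-trim K Q ltR (≤-trans b≤v (≤-trans (<⇒≤ v<k) k≤n)) (Pinched-sub ≤-refl (≤-trans b≤v (<⇒≤ v<k)) w)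
               (v′ , a≤v′ , v′<b , lv′) szR)
        where
        a≤b : a ≤ b
        a≤b = ≤-trans a≤v′ (<⇒≤ v′<b)
        nl-b : NoLev i b v
        nl-b = NoLev-sub v′<b ≤-refl nl′
        szX : ⟪ P ++ [ C ] ⟫ ≡ ⟪ P ⟫ + ⟨ C ⟩
        szX = trans (⟪++⟫ P [ C ]) (cong (⟪ P ⟫ +_) (+-identityʳ ⟨ C ⟩))
        szF : ⟨ plug K (node p (P ++ C ∷ Q)) ⟩ ≡ suc (⟪ P ⟫ + ⟨ C ⟩ + ⟪ Q ⟫) + ⟦ K ⟧
        szF = trans (⟨plug⟩ K (node p (P ++ C ∷ Q))) (cong (λ s → suc s + ⟦ K ⟧)
                (trans (⟪++⟫ P (C ∷ Q)) (sym (+-assoc ⟪ P ⟫ ⟨ C ⟩ ⟪ Q ⟫))))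
        szR : ⟪ Q ⟫ + ⟦ K ⟧ ≡ count i a b
        szR = cancel-cl {x = ⟪ P ⟫ + ⟨ C ⟩} szF sz (trans (count-split i a≤b (≤-trans b≤v (<⇒≤ v<k)))
                (cong (_+ count i a b) (trans (count-hole i b≤v v<k lv nl-b nl) (cong suc cnt))))
        ltX : ⟪ P ++ [ C ] ⟫ < m
        ltX = ≤-trans (s≤s (≤-trans (≤-reflexive szX) (m≤m+n _ ⟪ Q ⟫))) (≤-trans (m≤m+n _ ⟦ K ⟧) (≤-reflexive (trans (sym szF) szm)))
        ltR : ⟪ Q ⟫ + ⟦ K ⟧ < m
        ltR = ≤-trans (s≤s (+-monoˡ-≤ ⟦ K ⟧ (m≤n+m ⟪ Q ⟫ (⟪ P ⟫ + ⟨ C ⟩)))) (≤-reflexive (trans (sym szF) szm))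
        done : Emb* (suc i) b k (P ++ [ C ]) →
               (∃ λ L → map proj₂ L ↭ Il i a b × Real* L (trim K Q) × RootAt i L K) →
               Emb i a k (plug K (node p (P ++ C ∷ Q)))
        done (emb* L₁ onto₁ ok₁) (L₂ , onto₂ , ok₂ , rootAt)
          with centre k≤n w a≤b b≤v v<k lv nl-b nl p L₁ L₂ onto₁ onto₂
        ... | star L onto sub₁ sub₂ p-at@(j , p∈ , _) hub₁ hub₂ _ with Real-trim sub₂ K hub₂ ok₂
        ...   | c , h = emb L onto
                  (Real-plug⁺ K (real (j , p∈ , tt) (subst (Hung L p) (++-assoc P [ C ] Q) (++⁺ (hang sub₁ hub₁ ok₁) h))) c)
                  (λ _ → RootAt⇒At sub₂ K {ts = P ++ C ∷ Q} rootAt p-at)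

      -- The branches `P` occupy the right end `[e , k)`, leaving `N` places below `v`. The branch
      -- `C` is too large for these and the places below `v′`, so it has to be cut.
      module Overfull (K : Ctx) (p : Address) (P : Forest) (C : LTree) (Q : Forest)
                      (szm : ⟨ plug K (node p (P ++ C ∷ Q)) ⟩ ≡ m)
                      (sz : ⟨ plug K (node p (P ++ C ∷ Q)) ⟩ ≡ count i a k)
                      (C≤B : ⟨ C ⟩ ≤ count (suc i) v k)
                      {e : ℕ} (v<e : v < e) (e≤k : e ≤ k) (cnt-e : count (suc i) e k ≡ ⟪ P ⟫)
                      (N≥1 : 1 ≤ count (suc i) v e) (C-big : count (suc i) v e + l ≤ ⟨ C ⟩)
                      (LP : Placement) (ontoP : map proj₂ LP ↭ Il (suc i) e k)
                      (okP : All (λ t → At LP (root t) (λ j → lev j ≡ suc i) × Real LP t) P) where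

        N : ℕ
        N = count (suc i) v e

        szF : ⟨ plug K (node p (P ++ C ∷ Q)) ⟩ ≡ suc (⟪ P ⟫ + (⟨ C ⟩ + ⟪ Q ⟫)) + ⟦ K ⟧
        szF = trans (⟨plug⟩ K (node p (P ++ C ∷ Q))) (cong (λ s → suc s + ⟦ K ⟧) (⟪++⟫ P (C ∷ Q)))

        e≤n : e ≤ n
        e≤n = ≤-trans e≤k k≤n

        -- The f vertices cut off C go on [b , e); what is left of the tree, joined at g, goes on [a , b).
        record Rest (f : ℕ) (Qs : Forest) : Set where
          constructor rest
          field
            b         : ℕ
            v′<b      : v′ < b
            b≤v       : b ≤ v
            cnt-b     : count (suc i) b e ≡ f
            f<m       : f < m
            pinched   : Pinched (suc i) b e
            has-child : HasLev (suc i) b e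
            remainder : ∀ g → Remainder i a b (plug K (node g (Q ++ Qs))) g

        -- The extra one in the size of `C` is the vertex that goes on `v` or, when an edge is cut,
        -- the one that replaces `p`. The lower and upper bounds on `C` become the bounds that `fin`
        -- asks for.
        find-rest : ∀ {f} Qs → ⟨ C ⟩ ≡ suc (f + ⟪ Qs ⟫) → N ≤ f → 2 + f ≤ N + l → Rest f Qs
        find-rest {f} Qs szC lo hi with split-at f v<e lo (<-trans (n<1+n f) hi)
        ... | b , v′<b , b≤v , cnt-b , over = rest b v′<b b≤v cnt-b
          (≤-trans (group-less {s = ⟪ P ⟫} {f = f} szF szC) (≤-reflexive szm))
          (Pinched-hole nl-b (NoLev-sub ≤-refl e≤k nl))
          (let (c , r , s , t) = child-at e≤n lv N≥1 in c , ≤-trans b≤v (<⇒≤ r) , s , t)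
          remainder
          where
          a≤b : a ≤ b
          a≤b = ≤-trans a≤v′ (<⇒≤ v′<b)
          b≤k : b ≤ k
          b≤k = ≤-trans b≤v (<⇒≤ v<k)
          nl-b : NoLev i b v
          nl-b = NoLev-sub v′<b ≤-refl nl′
          cnt-bk : count (suc i) b k ≡ ⟪ P ⟫ + f
          cnt-bk = trans (count-split (suc i) (≤-trans b≤v (<⇒≤ v<e)) e≤k) (cong₂ _+_ cnt-e cnt-b)
          -- The `2` in `2 + f ≤ N + l` keeps one place below `v′` free.
          room : 1 ≤ count (suc i) v′ b
          room = +-cancelˡ-≤ (suc f) 1 _ (≤-trans (≤-reflexive (+-comm (suc f) 1)) (≤-trans hi (≤-reflexive (sym over))))
          remainder : ∀ g → Remainder i a b (plug K (node g (Q ++ Qs))) g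
          remainder g = fin K g Q Qs (≤-trans b≤k k≤n) (Pinched-sub ≤-refl b≤k w) a≤v′ v′<b lv′ (NoLev-sub ≤-refl b≤v nl′) room
            (λ a≤v″ nx″ → fin-lower {N} {l} C-big szC over ,
              fin-upper C≤B (subst (_≤ _) (trans (count-first i v<k lv nl) (cong suc (count-above i {v} {k} lv)))
                (two-left nx″ nx lv v<k k≤n nl)) szC over)
            (fin-size {s = ⟪ P ⟫} szF szC
              (trans sz (trans (count-split i a≤b b≤k)
                (cong (_+ count i a b) (trans (count-hole i b≤v v<k lv nl-b nl) (cong suc cnt-bk))))) szG)
            (≤-trans (fin-less {s = ⟪ P ⟫} {f = f} szF szC szG) (≤-reflexive szm))
            where
            szG : ⟨ plug K (node g (Q ++ Qs)) ⟩ ≡ suc (⟪ Q ⟫ + ⟪ Qs ⟫) + ⟦ K ⟧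
            szG = trans (⟨plug⟩ K (node g (Q ++ Qs))) (cong (λ s → suc s + ⟦ K ⟧) (⟪++⟫ Q Qs))

        -- A `Star` in which the roots of `P` lie on level `i + 1`; they can thus be hung on `v` as
        -- well as on any vertex of the remainder of level at most `i + 1`.
        record Joint (c : Address) (LG LF : Placement) : Set where
          constructor joint
          field
            M         : Placement
            onto      : map proj₂ M ↭ Il i a k
            subG      : LG ⊑ˡ M
            subF      : LF ⊑ˡ M
            c-at      : At M c (λ j → lev j ≡ i)
            hubG      : ∀ {x} → Placed LG x → Joined M c x
            hubF      : ∀ {x} → Placed LF x → Joined M c x
            cliqueGF  : ∀ {x y} → At LG x (λ j → lev j ≡ suc i) → At LF y (λ j → lev j ≤ suc i) → Joined M x y
            hungP     : ∀ {x} → At LF x (λ j → lev j ≤ suc i) → Hung M x P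
            hungP-hub : Hung M c P

        find-joint : ∀ {b} → v′ < b → b ≤ v → ∀ c LG LF → map proj₂ LG ↭ Il (suc i) b e → map proj₂ LF ↭ Il i a b →
                     Joint c LG LF
        find-joint v′<b b≤v c LG LF ontoG ontoF
          with centre k≤n w (≤-trans a≤v′ (<⇒≤ v′<b)) b≤v v<k lv (NoLev-sub v′<b ≤-refl nl′) nl c (LP ++ LG) LF
              (↭-trans (↭-reflexive (map-++ proj₂ LP LG)) (↭-trans (↭-++⁺ ontoP ontoG)
                (↭-reflexive (sym (Il-split (suc i) (≤-trans b≤v (<⇒≤ v<e)) e≤k))))) ontoF
        ... | star L onto sub₁ sub₂ c-at hub₁ hub₂ clique₁₂ = joint L onto (λ q → sub₁ (∈-++⁺ʳ LP q)) sub₂ c-at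
          (λ q → hub₁ (At-mono (∈-++⁺ʳ LP) q)) hub₂ (λ q r → clique₁₂ (At-mono (∈-++⁺ʳ LP) q) r)
          (λ x∈ → All.map (λ (q , r) → Joined-sym (clique₁₂ (At-mono ∈-++⁺ˡ q) x∈) ,
              Real-mono (λ s → sub₁ (∈-++⁺ˡ s)) r) okP)
          (All.map (λ ((j , q , _) , r) → hub₁ (j , ∈-++⁺ˡ q , tt) , Real-mono (λ s → sub₁ (∈-++⁺ˡ s)) r) okP)

        -- `y` goes on `v` and `X` on `[b , e)`; `p` stays in the remainder, low enough to be joined
        -- to the roots of `P`.
        deep-case : ∀ K′ y X Y → C ≡ plug K′ (node y (X ++ Y)) → N ≤ ⟪ X ⟫ → 2 + ⟪ X ⟫ ≤ N + l →
                    Emb i a k (plug K (node p (P ++ C ∷ Q)))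
        deep-case K′ y X Y eqC lo hi with find-rest (trim K′ Y) szC lo hi
          where
          szC : ⟨ C ⟩ ≡ suc (⟪ X ⟫ + ⟪ trim K′ Y ⟫)
          szC = trans (cong ⟨_⟩ eqC) (trans (⟨plug⟩ K′ (node y (X ++ Y)))
                  (cong suc (trans (cong (_+ ⟦ K′ ⟧) (⟪++⟫ X Y)) (trans (+-assoc ⟪ X ⟫ ⟪ Y ⟫ ⟦ K′ ⟧)
                    (cong (⟪ X ⟫ +_) (sym (⟪trim⟫ K′ Y)))))))
        ... | rest b v′<b b≤v cnt-b f<m pinched has-child remainder
          with IH* X f<m e≤n pinched (sym cnt-b) | remainder p
        ... | emb* LG ontoG okG | LF , ontoF , okF , root-at , p-at
          with find-joint v′<b b≤v y LG LF ontoG ontoF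
        ... | joint L onto subG subF (j , y∈ , _) hubG hubF _ hungP _ = emb L onto
          (subst (λ c → Real L (plug K (node p (P ++ c ∷ Q)))) (sym eqC)
            (Assemble.deep-ok subG subF K p P Q K′ y X Y (j , y∈ , tt) hubG hubF (hungP p-at) okG okF))
          (λ _ → subst (λ r → At L r (λ j → lev j ≡ i)) (root-plug-any K) (At-mono subF root-at))

        -- `q` goes on `v`. The root of `C`, if it is not `q`, is on level `i + 1` and `p` on level
        -- at most `i + 1`, so the clique provides their edge.
        wide-case : ∀ K′ q h X Y → C ≡ plug K′ (node q (h ∷ X ++ Y)) → N ≤ ⟦ K′ ⟧ + ⟪ X ⟫ →
                    2 + (⟦ K′ ⟧ + ⟪ X ⟫) ≤ N + l → Emb i a k (plug K (node p (P ++ C ∷ Q)))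
        wide-case K′ q h X Y eqC lo hi with find-rest {⟪ X ⟫ + ⟦ K′ ⟧} (h ∷ Y) szC
               (≤-trans lo (≤-reflexive (+-comm ⟦ K′ ⟧ ⟪ X ⟫)))
               (≤-trans (≤-reflexive (cong (2 +_) (+-comm ⟪ X ⟫ ⟦ K′ ⟧))) hi)
          where
          szC : ⟨ C ⟩ ≡ suc (⟪ X ⟫ + ⟦ K′ ⟧ + ⟪ h ∷ Y ⟫)
          szC = trans (cong ⟨_⟩ eqC) (trans (⟨plug⟩ K′ (node q (h ∷ X ++ Y)))
                  (cong suc (trans (cong (λ s → ⟨ h ⟩ + s + ⟦ K′ ⟧) (⟪++⟫ X Y)) (shuffle ⟨ h ⟩ ⟪ X ⟫ ⟪ Y ⟫ ⟦ K′ ⟧))))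
        ... | rest b v′<b b≤v cnt-b f<m pinched has-child remainder
          with place-trim {suc i} {b} {e} K′ X f<m e≤n pinched has-child (sym cnt-b) | remainder p
        ... | LG , ontoG , okG , rootG | LF , ontoF , okF , root-at , p-at
          with find-joint v′<b b≤v q LG LF ontoG ontoF
        ... | joint L onto subG subF (j , q∈ , _) hubG hubF cliqueGF hungP _ = emb L onto
          (subst (λ c → Real L (plug K (node p (P ++ c ∷ Q)))) (sym eqC)
            (Assemble.wide-ok subG subF K p P Q K′ q h X Y (j , q∈ , tt) hubG hubF (hungP p-at)
              (λ { f K″ refl → Joined-sym (cliqueGF rootG p-at) }) okG okF))
          (λ _ → subst (λ r → At L r (λ j → lev j ≡ i)) (root-plug-any K) (At-mono subF root-at))

        -- `p` goes on `v` and leaves its place to `r`. Both ends of the cut edge lie in the clique,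
        -- and `2 ≤ l` keeps the cut of size `N` within the admissible sizes.
        edge-case : 2 ≤ l → ∀ K′ q h ts → C ≡ plug K′ (node q (h ∷ ts)) → suc (⟪ ts ⟫ + ⟦ K′ ⟧) ≡ N →
                    Emb i a k (plug K (node p (P ++ C ∷ Q)))
        edge-case 2≤l K′ q (node r hs) ts eqC exact with find-rest {suc (⟪ ts ⟫ + ⟦ K′ ⟧)} hs szC
               (≤-reflexive (sym exact))
               (≤-trans (≤-reflexive (trans (cong (2 +_) exact) (+-comm 2 N))) (+-monoʳ-≤ N 2≤l))
          where
          szC : ⟨ C ⟩ ≡ suc (suc (⟪ ts ⟫ + ⟦ K′ ⟧) + ⟪ hs ⟫)
          szC = trans (cong ⟨_⟩ eqC) (trans (⟨plug⟩ K′ (node q (node r hs ∷ ts))) (shuffle′ ⟪ hs ⟫ ⟪ ts ⟫ ⟦ K′ ⟧))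
        ... | rest b v′<b b≤v cnt-b f<m pinched has-child remainder
          with IH (node q (ts ++ ups K′)) (subst (_< m) (sym szG) f<m) e≤n pinched (trans szG (sym cnt-b)) | remainder r
          where
          szG : ⟨ node q (ts ++ ups K′) ⟩ ≡ suc (⟪ ts ⟫ + ⟦ K′ ⟧)
          szG = cong suc (trans (⟪++⟫ ts (ups K′)) (cong (⟪ ts ⟫ +_) (⟪ups⟫ K′)))
        ... | emb LG ontoG okG highG | LF , ontoF , okF , root-at , r-at
          with find-joint v′<b b≤v p LG LF ontoG ontoF
        ... | joint L onto subG subF p-at@(j , p∈ , _) hubG hubF cliqueGF _ hungP = emb L onto
          (subst (λ c → Real L (plug K (node p (P ++ c ∷ Q)))) (sym eqC)
            (Assemble.edge-ok subG subF K p P Q K′ q r hs ts (j , p∈ , tt) hubG hubF hungP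
              (cliqueGF (highG has-child) r-at) okG okF))
          (λ _ → root-of K root-at)
          where
          root-of : ∀ K″ → At LF (root (plug K″ (node r (Q ++ hs)))) (λ j → lev j ≡ i) →
                    At L (root (plug K″ (node p (P ++ C ∷ Q)))) (λ j → lev j ≡ i)
          root-of []       _ = p-at
          root-of (f ∷ K″) x = subst (λ s → At L s (λ j → lev j ≡ i))
            (trans (root-plug f K″ _) (sym (root-plug f K″ _))) (At-mono subF x)

      -- With nothing below it, `v` takes the root, and the branches go left of `v`.
      leaf-case : ∀ t → ⟨ t ⟩ ≡ m → ⟨ t ⟩ ≡ count i a k → count (suc i) v k ≡ 0 → Emb i a k t
      leaf-case (node z ts) szm sz B≡0
        with IH* ts (≤-reflexive szm) (≤-trans (<⇒≤ v<k) k≤n) (Pinched-sub ≤-refl (<⇒≤ v<k) w)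
               (suc-injective (trans sz (trans (count-split i (≤-trans a≤v′ (<⇒≤ v′<v)) (<⇒≤ v<k))
                 (cong (_+ count i a v) (trans (count-first i v<k lv nl) (cong suc (trans (count-above i {v} {k} lv) B≡0)))))))
      ... | emb* L₂ onto₂ ok₂
        with centre k≤n w (≤-trans a≤v′ (<⇒≤ v′<v)) ≤-refl v<k lv (λ x p q → contradiction p (<⇒≱ q)) nl z [] L₂
               (↭-reflexive (sym (length-zero (sym B≡0)))) onto₂
      ... | star L onto sub₁ sub₂ (j , z∈ , lj) hub₁ hub₂ _ =
        emb L onto (real (j , z∈ , tt) (hang sub₂ hub₂ ok₂)) (λ _ → j , z∈ , lj)

      overfull-case : ∀ K p P C Q → Sorted C → ⟨ plug K (node p (P ++ C ∷ Q)) ⟩ ≡ m →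
                      ⟨ plug K (node p (P ++ C ∷ Q)) ⟩ ≡ count i a k → ⟨ C ⟩ ≤ count (suc i) v k →
                      ⟪ P ⟫ < count (suc i) v k → count (suc i) v k + l ≤ ⟪ P ⟫ + ⟨ C ⟩ →
                      All (λ t → ⟨ C ⟩ ≤ ⟨ t ⟩) P → 2 ≤ l → Emb i a k (plug K (node p (P ++ C ∷ Q)))
      overfull-case K p P C Q srt szm sz C≤B P<B over C≤P 2≤l
        with cut-at (suc i) {suc v} {k} k ⟪ P ⟫ v<k (≤-trans (≤-reflexive (count-empty (suc i) k)) z≤n)
               (≤-trans (<⇒≤ P<B) (≤-reflexive (sym (count-above i {v} {k} lv))))
      ... | e , v<e , e≤k , cnt-e = by-cut (cut N l N≥1 2≤l C srt C-big C+N<4l)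
              (place-all P nx lv v<e e≤k k≤n nl (All.map (≤-trans (≤-trans (m≤n+m l N) C-big)) C≤P)
                (≤-trans (pre-less {⟪ P ⟫} {⟨ C ⟩} {⟪ Q ⟫} szF) (≤-reflexive szm)) (sym cnt-e))
        where
        N : ℕ
        N = count (suc i) v e
        szF : ⟨ plug K (node p (P ++ C ∷ Q)) ⟩ ≡ suc (⟪ P ⟫ + (⟨ C ⟩ + ⟪ Q ⟫)) + ⟦ K ⟧
        szF = trans (⟨plug⟩ K (node p (P ++ C ∷ Q))) (cong (λ s → suc s + ⟦ K ⟧) (⟪++⟫ P (C ∷ Q)))
        B≡ : count (suc i) v k ≡ ⟪ P ⟫ + N
        B≡ = trans (count-split (suc i) (<⇒≤ v<e) e≤k) (cong (_+ N) cnt-e)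
        C-big : N + l ≤ ⟨ C ⟩
        C-big = +-cancelˡ-≤ ⟪ P ⟫ (N + l) ⟨ C ⟩ (≤-trans (≤-reflexive (trans (sym (+-assoc ⟪ P ⟫ N l)) (cong (_+ l) (sym B≡)))) over)
        N≥1 : 1 ≤ N
        N≥1 = +-cancelˡ-≤ ⟪ P ⟫ 1 N (≤-trans (≤-reflexive (+-comm ⟪ P ⟫ 1)) (≤-trans P<B (≤-reflexive B≡)))
        -- `P` is not empty, as `C` alone fits below `v`.
        C≤∣P∣ : ∀ P → All (λ t → ⟨ C ⟩ ≤ ⟨ t ⟩) P → count (suc i) v k + l ≤ ⟪ P ⟫ + ⟨ C ⟩ → ⟨ C ⟩ ≤ ⟪ P ⟫
        C≤∣P∣ []      _       o = contradiction (≤-trans o C≤B) (<⇒≱ (m<m+n _ (≤-trans (s≤s z≤n) 2≤l)))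
        C≤∣P∣ (t ∷ P) (h ∷ _) _ = ≤-trans h (m≤m+n _ _)
        -- `⟨ C ⟩ + N` is at most `⟪ P ⟫ + N`, the number of vertices below `v`; with `v` added, T2
        -- bounds that by `4 * l`.
        C+N<4l : ⟨ C ⟩ + N < 4 * l
        C+N<4l = ≤-trans (s≤s (≤-trans (+-monoˡ-≤ N (C≤∣P∣ P C≤P over)) (≤-reflexive (trans (sym B≡) (sym (count-above i {v} {k} lv))))))
          (≤-trans (≤-reflexive (sym (count-first i v<k lv nl))) (quarter nx lv v<k k≤n nl))
        by-cut : Cut N l C →
                 (∃ λ L → map proj₂ L ↭ Il (suc i) e k × All (λ t → At L (root t) (λ j → lev j ≡ suc i) × Real L t) P) →
                 Emb i a k (plug K (node p (P ++ C ∷ Q)))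
        by-cut ct (LP , ontoP , okP) = go ct
          where
          open Overfull K p P C Q szm sz C≤B v<e e≤k cnt-e N≥1 C-big LP ontoP okP using (deep-case; wide-case; edge-case)
          go : Cut N l C → Emb i a k (plug K (node p (P ++ C ∷ Q)))
          go (deep K′ y X Y eq lo hi)   = deep-case K′ y X Y eq lo hi
          go (wide K′ q h X Y eq lo hi) = wide-case K′ q h X Y eq lo hi
          go (edge K′ q h ts eq exact)  = edge-case 2≤l K′ q h ts eq exact

      sorted-case : ∀ t → Sorted t → ⟨ t ⟩ ≡ m → ⟨ t ⟩ ≡ count i a k → Emb i a k t
      sorted-case t srt szm sz with count (suc i) v k in B≡
      ... | zero  = leaf-case t szm sz B≡
      ... | suc B with findHeavy (suc B) [] t srt
              -- The interval contains `v` and the `suc B` vertices below it, so the tree has more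
              -- than `suc B` vertices.
              (≤-trans (≤-reflexive (trans (cong suc (trans (sym B≡) (sym (count-above i {v} {k} lv)))) (sym (count-first i v<k lv nl))))
                (≤-trans (m≤m+n _ _) (≤-reflexive (trans (sym (count-split i (≤-trans a≤v′ (<⇒≤ v′<v)) (<⇒≤ v<k))) (sym sz)))))
      ...   | heavy K p cs refl d srts small big with findGreedy (suc B) cs d (s≤s z≤n) big
      ...     | greedy P C Q refl P< ≤C C≤P with suc (⟪ P ⟫ + ⟨ C ⟩) ≤? suc B + l
      ...       | yes fits = centre-case K p P C Q szm sz (≤-trans (≤-reflexive B≡) ≤C) (≤-trans fits (≤-reflexive (cong (_+ l) (sym B≡))))
      ...       | no ¬fits = overfull-case K p P C Q (All.head (++⁻ʳ P srts)) szm sz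
                    (≤-trans (All.head (++⁻ʳ P small)) (≤-reflexive (sym B≡)))
                    (≤-trans P< (≤-reflexive (sym B≡))) (≤-trans (≤-reflexive (cong (_+ l) B≡)) (≤-pred (≰⇒> ¬fits))) C≤P
                    (fertile nx lv v<k k≤n nl (≤-trans (s≤s z≤n) (≤-reflexive (sym B≡))))

    -- If `v` is alone on level `i`, it takes the root and the branches go one level higher.
    with-top : ∀ {i a k v} t → Sorted t → ⟨ t ⟩ ≡ m → k ≤ n → Pinched i a k → ⟨ t ⟩ ≡ count i a k →
               a ≤ v → v < k → lev v ≡ i → NoLev i (suc v) k → Emb i a k t
    with-top {i} {a} {k} {v} t srt szm k≤n w sz a≤v v<k lv nl with last-lev i a v
    ... | inj₁ (v′ , a≤v′ , v′<v , lv′ , nl′) =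
      TwoLeft.sorted-case k≤n w a≤v′ (v′<v , lv′ , nl′) v<k lv nl t srt szm sz
    with-top {i} {a} {k} {v} (node z ts) srt szm k≤n w sz a≤v v<k lv nl | inj₂ nl₀
      with IH* ts (≤-reflexive szm) k≤n (Pinched-hole nl₀ nl) (suc-injective (trans sz (count-hole i a≤v v<k lv nl₀ nl)))
    ... | emb* L₁ onto₁ ok₁
      with centre k≤n w ≤-refl a≤v v<k lv nl₀ nl z L₁ [] onto₁ (↭-reflexive (sym (Il-empty i a a ≤-refl)))
    ... | star L onto sub₁ sub₂ (j , z∈ , lj) hub₁ hub₂ _ =
      emb L onto (real (j , z∈ , tt) (hang sub₁ hub₁ ok₁)) (λ _ → j , z∈ , lj)

    -- If level `i` is absent, `i + 1` describes the same set and the condition on level `i` holds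
    -- vacuously. The recursion is on the distance `d` to the level of some vertex `x` of the set.
    climb : ∀ {x} d {i a k} t → a ≤ x → x < k → lev x ≡ d + i → Sorted t → ⟨ t ⟩ ≡ m → k ≤ n → Pinched i a k →
            ⟨ t ⟩ ≡ count i a k → Emb i a k t
    climb {x} d {i} {a} {k} t a≤x x<k lx srt szm k≤n w sz with last-lev i a k
    ... | inj₁ (v , a≤v , v<k , lv , nl) = with-top t srt szm k≤n w sz a≤v v<k lv nl
    climb zero t a≤x x<k lx srt szm k≤n w sz | inj₂ nl = contradiction lx (nl _ a≤x x<k)
    climb (suc d) {i} {a} {k} t a≤x x<k lx srt szm k≤n w sz | inj₂ nl
      with climb d {suc i} t a≤x x<k (trans lx (sym (+-suc d i))) srt szm k≤n (Pinched-none nl) (trans sz (cong length (Il-suc i a k nl)))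
    ... | emb L onto ok _ = emb L (↭-trans onto (↭-reflexive (sym (Il-suc i a k nl)))) ok
                              (λ (v , a≤v , v<k , lv) → contradiction lv (nl v a≤v v<k))

    step : ∀ {i a k} t → ⟨ t ⟩ ≡ m → k ≤ n → Pinched i a k → ⟨ t ⟩ ≡ count i a k → Emb i a k t
    step {i} {a} {k} t szm k≤n w sz
      with count-pos⁻ i a k (≤-trans (⟨t⟩>0 t) (≤-reflexive sz))
    ... | x , a≤x , x<k , lx
      with climb (lev x ∸ i) (sort t) a≤x x<k (sym (m∸n+n≡m lx)) (sort-sorted t) (trans (⟨sort⟩ t) szm) k≤n w (trans (⟨sort⟩ t) sz)
    ... | emb L onto ok high = emb L onto (Real-sort⁻ t ok)
                                 (λ h → subst (λ r → At L r (λ j → lev j ≡ i)) (root-sort t) (high h))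

  embeds : ∀ m → Hyp m
  embeds (suc m) t (s≤s t≤m) with m≤n⇒m<n∨m≡n t≤m
  ... | inj₁ t<m = embeds m t t<m
  ... | inj₂ t≡m = Step.step m (embeds m) t t≡m

-- Preorder numbering

∈-delete : ∀ {X : Set} {x y : X} as {bs} → y ∈ as ++ x ∷ bs → y ≢ x → y ∈ as ++ bs
∈-delete as y∈ y≢x with ∈-++⁻ as y∈
... | inj₁ p           = ∈-++⁺ˡ p
... | inj₂ (here refl) = contradiction refl y≢x
... | inj₂ (there p)   = ∈-++⁺ʳ as p

length-delete : ∀ {X : Set} {x : X} as {bs} → length (as ++ x ∷ bs) ≡ suc (length (as ++ bs))
length-delete []       = refl
length-delete (_ ∷ as) = cong suc (length-delete as)

unique-length : ∀ {X : Set} {xs ys : List X} → Unique xs → (∀ {x} → x ∈ xs → x ∈ ys) → length xs ≤ length ys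
unique-length {xs = []} _ _ = z≤n
unique-length {xs = x ∷ xs} (x∉ ∷ u) sub with ∈-∃++ (sub (here refl))
... | as , bs , refl = subst (suc (length xs) ≤_) (sym (length-delete as))
        (s≤s (unique-length u (λ y∈ → ∈-delete as (sub (there y∈)) (λ { refl → All.lookup x∉ y∈ refl }))))

-- If two distinct entries had the same value, one could be deleted without losing a value, leaving
-- a list too short to cover `xs`.
pigeonhole : ∀ {X Y : Set} (h : X → Y) {L e e′} xs → Unique xs → (∀ {x} → x ∈ xs → x ∈ map h L) →
             length L ≤ length xs → e ∈ L → e′ ∈ L → h e ≡ h e′ → ¬ (e ≢ e′)
pigeonhole h {L} {e} {e′} xs u sub L≤ e∈ e′∈ he e≢ with ∈-∃++ e∈
... | as , bs , refl = <-irrefl refl (≤-trans (≤-reflexive (sym (length-delete as)))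
        (≤-trans L≤ (≤-trans (unique-length u sub′) (≤-reflexive (length-map h (as ++ bs))))))
  where
  e′∈′ : e′ ∈ as ++ bs
  e′∈′ = ∈-delete as e′∈ (e≢ ∘ sym)
  sub′ : ∀ {x} → x ∈ xs → x ∈ map h (as ++ bs)
  sub′ x∈ with ∈-map⁻ h (sub x∈)
  ... | d , d∈ , refl with ∈-++⁻ as d∈
  ...   | inj₁ p           = ∈-map⁺ h (∈-++⁺ˡ p)
  ...   | inj₂ (here refl) = subst (_∈ map h (as ++ bs)) (sym he) (∈-map⁺ h e′∈′)
  ...   | inj₂ (there p)   = ∈-map⁺ h (∈-++⁺ʳ as p)

-- Preorder and prefixes of addresses

≺-irrefl : ∀ {u} → ¬ (u ≺ u)
≺-irrefl (head≺ p) = <-irrefl refl p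
≺-irrefl (tail≺ p) = ≺-irrefl p

≺-asym : ∀ {u w} → u ≺ w → ¬ (w ≺ u)
≺-asym (head≺ p) (head≺ q) = <-asym p q
≺-asym (head≺ p) (tail≺ q) = <-irrefl refl p
≺-asym (tail≺ p) (head≺ q) = <-irrefl refl q
≺-asym (tail≺ p) (tail≺ q) = ≺-asym p q

⊑-convex : ∀ {u q y} → u ⊑ y → u ≺ q → q ≺ y → u ⊑ q
⊑-convex (r , refl) []≺       _         = _ , refl
⊑-convex (r , refl) (head≺ p) (head≺ q) = contradiction q (<-asym p)
⊑-convex (r , refl) (head≺ p) (tail≺ q) = contradiction p (<-irrefl refl)
⊑-convex (r , refl) (tail≺ p) (head≺ q) = contradiction q (<-irrefl refl)
⊑-convex (r , refl) (tail≺ p) (tail≺ q) with ⊑-convex (r , refl) p q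
... | s , refl = s , refl

≺-below : ∀ u {x r} → u ≺ (u ++ x ∷ r)
≺-below []      = []≺
≺-below (_ ∷ u) = tail≺ (≺-below u)

≺-prefix : ∀ u {x y r s} → x < y → (u ++ x ∷ r) ≺ (u ++ y ∷ s)
≺-prefix []      p = head≺ p
≺-prefix (_ ∷ u) p = tail≺ (≺-prefix u p)

⊑-length : ∀ {u w} → u ⊑ w → length u ≤ length w
⊑-length {u} (r , refl) = ≤-trans (m≤m+n _ _) (≤-reflexive (sym (length-++ u)))

⊑-same : ∀ {u w} → u ⊑ w → length w ≤ length u → u ≡ w
⊑-same {u} ([] , refl)    _ = sym (++-identityʳ u)
⊑-same {u} (x ∷ r , refl) p =
  contradiction (≤-trans (≤-reflexive (sym (length-++ u))) p) (<⇒≱ (m<m+n (length u) (s≤s z≤n)))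

⊑-strict : ∀ {u w} → u ⊑ w → u ≢ w → ∃₂ λ x r → w ≡ u ++ x ∷ r
⊑-strict {u} ([] , refl)    u≢w = contradiction (sym (++-identityʳ u)) u≢w
⊑-strict     (x ∷ r , refl) u≢w = x , r , refl

take-⊑ : ∀ i u → take i u ⊑ u
take-⊑ i u = drop i u , take++drop≡id i u

-- Listing the vertices in preorder

mutual
  pre : Tree → List Address
  pre (node cs) = [] ∷ preL 0 cs

  preL : ℕ → List Tree → List Address
  preL j []       = []
  preL j (c ∷ cs) = map (j ∷_) (pre c) ++ preL (suc j) cs

mutual
  length-pre : ∀ t → length (pre t) ≡ size t
  length-pre (node cs) = cong suc (length-preL 0 cs)

  length-preL : ∀ j cs → length (preL j cs) ≡ sizeL cs
  length-preL j []       = refl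
  length-preL j (c ∷ cs) = trans (length-++ (map (j ∷_) (pre c)))
    (cong₂ _+_ (trans (length-map (j ∷_) (pre c)) (length-pre c)) (length-preL (suc j) cs))

mutual
  ∈-pre⁺ : ∀ t u {s} → subtree t u ≡ just s → u ∈ pre t
  ∈-pre⁺ (node cs) []      e = here refl
  ∈-pre⁺ (node cs) (i ∷ u) e = there (∈-preL⁺ 0 cs i u e)

  ∈-preL⁺ : ∀ j cs i u {s} → subtreeL cs i u ≡ just s → (j + i ∷ u) ∈ preL j cs
  ∈-preL⁺ j (c ∷ cs) zero    u e = ∈-++⁺ˡ (subst (λ k → (k ∷ u) ∈ map (j ∷_) (pre c)) (sym (+-identityʳ j))
                                     (∈-map⁺ (j ∷_) (∈-pre⁺ c u e)))
  ∈-preL⁺ j (c ∷ cs) (suc i) u e = ∈-++⁺ʳ (map (j ∷_) (pre c))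
    (subst (λ k → (k ∷ u) ∈ preL (suc j) cs) (sym (+-suc j i)) (∈-preL⁺ (suc j) cs i u e))

mutual
  ∈-pre⁻ : ∀ t {u} → u ∈ pre t → Vertex t u
  ∈-pre⁻ (node cs) (here refl) = node cs , refl
  ∈-pre⁻ (node cs) (there u∈) with ∈-preL⁻ 0 cs u∈
  ... | i , w , s , refl , e = s , e

  ∈-preL⁻ : ∀ j cs {u} → u ∈ preL j cs → ∃ λ i → ∃ λ w → ∃ λ s → u ≡ j + i ∷ w × subtreeL cs i w ≡ just s
  ∈-preL⁻ j (c ∷ cs) u∈ with ∈-++⁻ (map (j ∷_) (pre c)) u∈
  ... | inj₂ p with ∈-preL⁻ (suc j) cs p
  ...   | i , w , s , refl , e = suc i , w , s , cong (_∷ w) (sym (+-suc j i)) , e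
  ∈-preL⁻ j (c ∷ cs) u∈ | inj₁ p with ∈-map⁻ (j ∷_) p
  ... | w , w∈ , refl = let (s , e) = ∈-pre⁻ c w∈ in 0 , w , s , cong (_∷ w) (sym (+-identityʳ j)) , e

preL-head : ∀ j cs → All (λ u → ∃₂ λ x w → u ≡ x ∷ w × j ≤ x) (preL j cs)
preL-head j cs = All.tabulate (λ u∈ → let (i , w , _ , eq , _) = ∈-preL⁻ j cs u∈ in j + i , w , eq , m≤m+n j i)

mutual
  pre-sorted : ∀ t → AllPairs _≺_ (pre t)
  pre-sorted (node cs) = All.map (λ { (x , w , refl , _) → []≺ }) (preL-head 0 cs) ∷ preL-sorted 0 cs

  preL-sorted : ∀ j cs → AllPairs _≺_ (preL j cs)
  preL-sorted j []       = []
  preL-sorted j (c ∷ cs) = AllPairsₚ.++⁺ (AllPairsₚ.map⁺ (AllPairs.map tail≺ (pre-sorted c))) (preL-sorted (suc j) cs)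
    (Allₚ.map⁺ (All.tabulate (λ _ → All.map (λ { (x , w , refl , j<x) → head≺ j<x }) (preL-head (suc j) cs))))

pre-unique : ∀ t → Unique (pre t)
pre-unique t = AllPairs.map (λ { p refl → ≺-irrefl p }) (pre-sorted t)

nth : List Address → ℕ → Address
nth []       _       = []
nth (u ∷ us) zero    = u
nth (u ∷ us) (suc j) = nth us j

nth-∈ : ∀ us {j} → j < length us → nth us j ∈ us
nth-∈ (u ∷ us) {zero}  _       = here refl
nth-∈ (u ∷ us) {suc j} (s≤s p) = there (nth-∈ us p)

∈-nth : ∀ {us u} → u ∈ us → ∃ λ j → j < length us × nth us j ≡ u
∈-nth (here refl) = 0 , s≤s z≤n , refl
∈-nth (there u∈)  = let (j , p , e) = ∈-nth u∈ in suc j , s≤s p , e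

nth-mono : ∀ {us j k} → AllPairs _≺_ us → j < k → k < length us → nth us j ≺ nth us k
nth-mono {u ∷ us} {zero}  {suc k} (p ∷ _)  _       (s≤s k<) = All.lookup p (nth-∈ us k<)
nth-mono {u ∷ us} {suc j} {suc k} (_ ∷ ps) (s≤s q) (s≤s k<) = nth-mono ps q k<

mutual
  subtree-++ : ∀ t u q {s} → subtree t u ≡ just s → subtree t (u ++ q) ≡ subtree s q
  subtree-++ t         []      q refl = refl
  subtree-++ (node cs) (i ∷ u) q e    = subtreeL-++ cs i u q e

  subtreeL-++ : ∀ cs i u q {s} → subtreeL cs i u ≡ just s → subtreeL cs i (u ++ q) ≡ subtree s q
  subtreeL-++ (c ∷ cs) zero    u q e = subtree-++ c u q e
  subtreeL-++ (c ∷ cs) (suc i) u q e = subtreeL-++ cs i u q e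

mutual
  subtree-prefix : ∀ t u q → Vertex t (u ++ q) → Vertex t u
  subtree-prefix t         []      q _ = t , refl
  subtree-prefix (node cs) (i ∷ u) q v = subtreeL-prefix cs i u q v

  subtreeL-prefix : ∀ cs i u q → (∃ λ s → subtreeL cs i (u ++ q) ≡ just s) → ∃ λ s → subtreeL cs i u ≡ just s
  subtreeL-prefix (c ∷ cs) zero    u q v = subtree-prefix c u q v
  subtreeL-prefix (c ∷ cs) (suc i) u q v = subtreeL-prefix cs i u q v

Vertex-⊑ : ∀ {t u w} → u ⊑ w → Vertex t w → Vertex t u
Vertex-⊑ {t} {u} (q , refl) = subtree-prefix t u q

-- Ancestors and subtrees as intervals of positions

module Numbering (T : Tree) where

  n : ℕ
  n = length (pre T)

  addr : ℕ → Address
  addr = nth (pre T)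

  lev : ℕ → ℕ
  lev j = length (addr j)

  open Levels lev

  vertex : ∀ {j} → j < n → Vertex T (addr j)
  vertex p = ∈-pre⁻ T (nth-∈ (pre T) p)

  position : ∀ {u} → Vertex T u → ∃ λ j → j < n × addr j ≡ u
  position {u} (s , e) = ∈-nth (∈-pre⁺ T u e)

  addr-mono : ∀ {j k} → j < k → k < n → addr j ≺ addr k
  addr-mono = nth-mono (pre-sorted T)

  addr-cancel : ∀ {j k} → j < n → addr j ≺ addr k → j < k
  addr-cancel {j} {k} j<n p with <-cmp j k
  ... | tri< j<k _ _  = j<k
  ... | tri≈ _ refl _ = contradiction p ≺-irrefl
  ... | tri> _ _ k<j  = contradiction (addr-mono k<j j<n) (≺-asym p)

  addr-injective : ∀ {j k} → j < n → k < n → addr j ≡ addr k → j ≡ k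
  addr-injective {j} {k} j<n k<n e with <-cmp j k
  ... | tri< j<k _ _ = contradiction (subst (_≺ addr k) e (addr-mono j<k k<n)) ≺-irrefl
  ... | tri≈ _ j≡k _ = j≡k
  ... | tri> _ _ k<j = contradiction (subst (addr k ≺_) e (addr-mono k<j j<n)) ≺-irrefl

  ⊑⇒≤ : ∀ {g j} → g < n → addr g ⊑ addr j → g ≤ j
  ⊑⇒≤ {g} {j} g<n (r , e) with r
  ... | []    = ≮⇒≥ (λ j<g → ≺-irrefl (subst (_≺ addr g) (trans (sym e) (++-identityʳ _)) (addr-mono j<g g<n)))
  ... | x ∷ r = <⇒≤ (addr-cancel g<n (subst (addr g ≺_) e (≺-below (addr g))))

  ⊑-between : ∀ {g x j} → g ≤ x → x ≤ j → j < n → addr g ⊑ addr j → addr g ⊑ addr x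
  ⊑-between g≤x x≤j j<n p with m≤n⇒m<n∨m≡n g≤x | m≤n⇒m<n∨m≡n x≤j
  ... | inj₂ refl | _         = [] , ++-identityʳ _
  ... | inj₁ _    | inj₂ refl = p
  ... | inj₁ g<x  | inj₁ x<j  = ⊑-convex p (addr-mono g<x (<-trans x<j j<n)) (addr-mono x<j j<n)

  record Ancestor (i j : ℕ) : Set where
    constructor ancestor
    field
      pos  : ℕ
      ≤j   : pos ≤ j
      eq   : addr pos ≡ take i (addr j)
      lev≡ : lev pos ≡ i
      pref : addr pos ⊑ addr j

  anc-at : ∀ i {j} → j < n → i ≤ lev j → Ancestor i j
  anc-at i {j} j<n i≤ with position (Vertex-⊑ (take-⊑ i (addr j)) (vertex j<n))
  ... | g , g<n , e = ancestor g (⊑⇒≤ g<n p) e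
          (trans (cong length e) (trans (length-take i (addr j)) (m≤n⇒m⊓n≡m i≤))) p
    where
    p : addr g ⊑ addr j
    p = subst (_⊑ addr j) (sym e) (take-⊑ i (addr j))

  -- Otherwise `h` would lie between `g` and its descendant `x`, hence be a descendant of `g` on the
  -- same level.
  disjoint : ∀ {g h x} → x < n → addr g ⊑ addr x → lev g ≡ lev h → g < h → x < h
  disjoint {g} {h} {x} x<n p e g<h = ≰⇒> λ h≤x →
    <-irrefl (addr-injective (<-trans g<h (≤-<-trans h≤x x<n)) (≤-<-trans h≤x x<n)
      (⊑-same (⊑-between (<⇒≤ g<h) h≤x x<n p) (≤-reflexive (sym e)))) g<h

  -- The ancestor of `x` on level `i` cannot precede `v`, as its subtree would end before `v`, nor
  -- follow `v`, the last of its level.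
  under : ∀ {i v x k} → k ≤ n → v ≤ x → x < k → lev v ≡ i → NoLev i (suc v) k → i ≤ lev x → addr v ⊑ addr x
  under {i} {v} {x} k≤n v≤x x<k lv nl i≤ with anc-at i (<-≤-trans x<k k≤n) i≤
  ... | ancestor g g≤x _ lg p with <-cmp g v
  ...   | tri< g<v _ _  = contradiction v≤x (<⇒≱ (disjoint (<-≤-trans x<k k≤n) p (trans lg (sym lv)) g<v))
  ...   | tri≈ _ refl _ = p
  ...   | tri> _ _ v<g  = contradiction lg (nl g v<g (≤-<-trans g≤x x<k))

  -- The parent of `suc x` is at or before `x`, so `x` lies in its subtree.
  lev-step : ∀ x → suc x < n → lev (suc x) ≤ suc (lev x)
  lev-step x sx<n with lev (suc x) in e
  ... | zero  = z≤n
  ... | suc i with anc-at i sx<n (≤-trans (n≤1+n i) (≤-reflexive (sym e)))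
  ...   | ancestor g g≤ _ lg p = s≤s (≤-trans (≤-reflexive (sym lg))
            (⊑-length (⊑-between (≤-pred (≤∧≢⇒< g≤ (λ { refl → 1+n≢n (trans (sym e) lg) }))) (n≤1+n x) sx<n p)))

  -- Adjacency in the host graph

  infix 4 _~_
  _~_ : ℕ → ℕ → Set
  x ~ y = Edge 2 T (addr x) (addr y)

  ~-sym : ∀ {x y} → x ~ y → y ~ x
  ~-sym (p , q , r , s) = q , p , ≢-sym r , ⊎-swap s

  arc : ∀ {x y} → x < n → y < n → x ≢ y → Arc 2 T (addr x) (addr y) → x ~ y
  arc x<n y<n x≢y a = vertex x<n , vertex y<n , (λ e → x≢y (addr-injective x<n y<n e)) , inj₁ a

  nearest-left : ∀ {u v} → v < n → u < v → lev u ≡ lev v → NoLev (lev v) (suc u) v → NL T (addr v) (addr u)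
  nearest-left {u} {v} v<n u<v e nl = vertex (<-trans u<v v<n) , e , addr-mono u<v v<n , none
    where
    none : ∀ w → Vertex T w → L w ≡ lev v → addr u ≺ w → ¬ (w ≺ addr v)
    none w vw lw p q with position {w} vw
    ... | y , y<n , refl = nl y (addr-cancel (<-trans u<v v<n) p) (addr-cancel y<n q) lw

  nearest-right : ∀ {u v} → v < n → u < v → lev u ≡ lev v → NoLev (lev v) (suc u) v → NR T (addr u) (addr v)
  nearest-right {u} {v} v<n u<v e nl = vertex v<n , sym e , addr-mono u<v v<n , none
    where
    none : ∀ w → Vertex T w → L w ≡ lev u → addr u ≺ w → ¬ (w ≺ addr v)
    none w vw lw p q with position {w} vw
    ... | y , y<n , refl = nl y (addr-cancel (<-trans u<v v<n) p) (addr-cancel y<n q) (trans lw e)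

  -- A vertex of level `i` strictly between `g` and `h` comes after `x`, which is in the subtree of
  -- `g`. So it and `h` would be two vertices of level `i` in `[a , k)`; `g` itself may lie before
  -- `a`.
  consecutive : ∀ {i a k x y g h} → k ≤ n → Pinched (suc i) a k → a ≤ x → x < k → y < k →
                lev g ≡ i → addr g ⊑ addr x → lev h ≡ i → h ≤ y → g < h → NoLev (lev h) (suc g) h
  consecutive {x = x} {g = g} {h} k≤n w a≤x x<k y<k lg p lh h≤y g<h z g<z z<h lz =
    <-irrefl (w z h (≤-trans a≤x (<⇒≤ x<z)) (<-trans z<h h<k) (≤-trans a≤x (<⇒≤ (<-trans x<z z<h))) h<k
      (cong suc (trans lz lh)) (cong suc lh)) z<h
    where
    h<k = ≤-<-trans h≤y y<k
    x<z : x < z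
    x<z = disjoint (<-≤-trans x<k k≤n) p (trans lg (trans (sym lh) (sym lz))) g<z

  -- Descendants of `v` come under G1. For `x` before `v`, take its ancestor `g` on the level of the
  -- parent `h` of `v`: if they coincide, G2 applies; otherwise `g` is the nearest left cousin of
  -- `h`, and G3 applies.
  hub : ∀ {i a v k x} → k ≤ n → Pinched i a k → a ≤ v → v < k → lev v ≡ i → NoLev i (suc v) k →
        a ≤ x → x < k → i ≤ lev x → x ≢ v → v ~ x
  hub {i} {a} {v} {k} {x} k≤n w a≤v v<k lv nl a≤x x<k i≤ x≢v with <-cmp x v
  ... | tri≈ _ e _   = contradiction e x≢v
  ... | tri> _ _ v<x = arc (<-≤-trans v<k k≤n) (<-≤-trans x<k k≤n) (≢-sym x≢v)
          (G1 (under k≤n (<⇒≤ v<x) x<k lv nl i≤)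
            (λ e → x≢v (sym (addr-injective (<-≤-trans v<k k≤n) (<-≤-trans x<k k≤n) e))))
  hub {zero} {a} {v} {k} {x} k≤n w a≤v v<k lv nl a≤x x<k i≤ x≢v | tri< x<v _ _
    with addr v in e
  ... | [] = contradiction (⊑⇒≤ (<-≤-trans v<k k≤n) (addr x , cong (_++ addr x) e)) (<⇒≱ x<v)
  hub {suc i} {a} {v} {k} {x} k≤n w a≤v v<k lv nl a≤x x<k i≤ x≢v | tri< x<v _ _
    with anc-at i {v} (<-≤-trans v<k k≤n) (≤-trans (n≤1+n i) (≤-reflexive (sym lv)))
       | anc-at i {x} (<-≤-trans x<k k≤n) (≤-trans (n≤1+n i) i≤)
  ... | ancestor h h≤v _ lh p | ancestor g g≤x _ lg q
    with ⊑-strict p (λ e → 1+n≢n (trans (sym lv) (trans (cong length (sym e)) lh)))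
  ... | s , r , ev = arc v<n x<n (≢-sym x≢v) (by-order (<-cmp g h))
    where
    v<n = <-≤-trans v<k k≤n
    x<n = <-≤-trans x<k k≤n
    child : ∀ r → addr v ≡ addr h ++ s ∷ r → addr v ≡ addr h ∷ʳ s
    child []      e = e
    child (o ∷ r) e = contradiction (trans (sym lv) (trans (cong length e) (trans (length-++ (addr h)) (cong (_+ length (s ∷ o ∷ r)) lh))))
                        (<⇒≢ (≤-trans (s≤s (m≤m+n (suc i) (length r)))
                          (≤-reflexive (sym (trans (+-suc i (suc (length r))) (cong suc (+-suc i (length r))))))))
    v-child : addr v ≡ addr h ∷ʳ s
    v-child = child r ev
    by-order : _ → Arc 2 T (addr v) (addr x)
    by-order (tri< g<h _ _) = G3 (addr h) s v-child (addr g)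
      (nearest-left (≤-<-trans h≤v v<n) g<h (trans lg (sym lh)) (consecutive k≤n w a≤x x<k v<k lg q lh h≤v g<h)) q
    by-order (tri> _ _ h<g) = contradiction (disjoint v<n p (trans lh (sym lg)) h<g) (<⇒≯ (≤-<-trans g≤x x<v))
    by-order (tri≈ _ refl _)
      with ⊑-strict q (λ e → <-irrefl (trans (sym lg) (cong length e)) i≤)
    ... | s′ , r′ , ex = G2 (addr g ∷ʳ s′) (Vertex-⊑ w⊑x (vertex x<n) , addr g , s , s′ , v-child , refl , s′<s) w⊑x
      where
      w⊑x : (addr g ∷ʳ s′) ⊑ addr x
      w⊑x = r′ , trans (++-assoc (addr g) [ s′ ] r′) (sym ex)
      s′<s : s′ < s
      s′<s with <-cmp s′ s
      ... | tri< lt _ _   = lt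
      ... | tri≈ _ refl _ = contradiction (⊑⇒≤ v<n (subst (_⊑ addr x) (sym v-child) w⊑x)) (<⇒≱ x<v)
      ... | tri> _ _ gt   = contradiction (addr-cancel v<n (subst₂ _≺_ (sym v-child) (sym ex) (≺-prefix (addr g) gt))) (<⇒≯ x<v)

  -- For `i = 0` the second ancestor of `x` is the root. Otherwise it has level `i − 1`, where the
  -- ancestors of `x` and `y` coincide or are nearest cousins; this is G4.
  low : ∀ {i a k x y} → k ≤ n → Pinched i a k → a ≤ x → x < k → a ≤ y → y < k →
        lev x ≡ suc i → i ≤ lev y → lev y ≤ suc i → x ≢ y → x ~ y
  low {zero} {x = x} {y} k≤n w a≤x x<k a≤y y<k lx i≤ ≤i x≢y =
    arc (<-≤-trans x<k k≤n) (<-≤-trans y<k k≤n) x≢y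
      (G4 [] (inj₁ (sym (cong (λ m → take (m ∸ 2) (addr x)) lx))) (addr y , refl) (≤-trans ≤i (≤-reflexive (sym lx))))
  low {suc i} {a} {k} {x} {y} k≤n w a≤x x<k a≤y y<k lx i≤ ≤i x≢y
    with anc-at i {x} (<-≤-trans x<k k≤n) (≤-trans (≤-trans (n≤1+n i) (n≤1+n _)) (≤-reflexive (sym lx)))
       | anc-at i {y} (<-≤-trans y<k k≤n) (≤-trans (n≤1+n i) i≤)
  ... | ancestor g g≤x eg lg p | ancestor h h≤y eh lh q =
    arc x<n y<n x≢y (G4 (addr h) (subst (λ u → addr h ≡ u ⊎ NL T u (addr h) ⊎ NR T u (addr h)) g≡ (by-order (<-cmp g h)))
      q (≤-trans ≤i (≤-reflexive (sym lx))))
    where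
    x<n = <-≤-trans x<k k≤n
    y<n = <-≤-trans y<k k≤n
    g≡ : addr g ≡ anc 2 (addr x)
    g≡ = trans eg (sym (cong (λ m → take (m ∸ 2) (addr x)) lx))
    by-order : _ → addr h ≡ addr g ⊎ NL T (addr g) (addr h) ⊎ NR T (addr g) (addr h)
    by-order (tri≈ _ refl _) = inj₁ refl
    by-order (tri> _ _ h<g)  = inj₂ (inj₁ (nearest-left (≤-<-trans g≤x x<n) h<g (trans lh (sym lg))
                                 (consecutive k≤n w a≤y y<k x<k lh q lg g≤x h<g)))
    by-order (tri< g<h _ _)  = inj₂ (inj₂ (nearest-right (≤-<-trans h≤y y<n) g<h (trans lg (sym lh))
                                 (consecutive k≤n w a≤x x<k y<k lg p lh h≤y g<h)))

  clique : ∀ {i a k x y} → k ≤ n → Pinched i a k → a ≤ x → x < k → a ≤ y → y < k →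
           i ≤ lev x → lev x ≤ suc i → i ≤ lev y → lev y ≤ suc i → x ≢ y → x ~ y
  clique {i} {a} {k} {x} {y} k≤n w a≤x x<k a≤y y<k i≤x x≤i i≤y y≤i x≢y
    with m≤n⇒m<n∨m≡n x≤i | m≤n⇒m<n∨m≡n y≤i
  ... | inj₂ lx | _ = low k≤n w a≤x x<k a≤y y<k lx i≤y y≤i x≢y
  ... | inj₁ _  | inj₂ ly = ~-sym (low k≤n w a≤y y<k a≤x x<k ly i≤x x≤i (≢-sym x≢y))
  ... | inj₁ lx | inj₁ ly with <-cmp x y
  -- Both are on level `i`: ending the interval at the later one makes it the last of its level.
  ...   | tri< x<y _ _ = ~-sym (hub (≤-trans y<k k≤n) (Pinched-sub ≤-refl y<k w) a≤y ≤-refl (≤-antisym (≤-pred ly) i≤y)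
                           (λ z p q → contradiction (≤-pred q) (<⇒≱ p)) a≤x (m<n⇒m<1+n x<y) i≤x x≢y)
  ...   | tri≈ _ e _   = contradiction e x≢y
  ...   | tri> _ _ y<x = hub (≤-trans x<k k≤n) (Pinched-sub ≤-refl x<k w) a≤x ≤-refl (≤-antisym (≤-pred lx) i≤x)
                           (λ z p q → contradiction (≤-pred q) (<⇒≱ p)) a≤y (m<n⇒m<1+n y<x) i≤y (≢-sym x≢y)

  Il-unique : ∀ i a k → Unique (Il i a k)
  Il-unique i a zero = []
  Il-unique i a (suc k) with keep? i a k
  ... | yes _ = All.tabulate (λ x∈ → >⇒≢ (proj₁ (proj₂ (∈-Il⁻ i a k x∈)))) ∷ Il-unique i a k
  ... | no _  = Il-unique i a k

  addrs-unique : ∀ {xs} → All (_< n) xs → Unique xs → Unique (map addr xs)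
  addrs-unique []       []       = []
  addrs-unique (p ∷ ps) (q ∷ qs) = All-map q ps ∷ addrs-unique ps qs
    where
    All-map : ∀ {xs} → All (_ ≢_) xs → All (_< n) xs → All (addr _ ≢_) (map addr xs)
    All-map []       []       = []
    All-map (q ∷ qs) (r ∷ rs) = (λ e → q (addr-injective p r e)) ∷ All-map qs rs

  -- Subtree sizes and the conditions T1-T4

  descendants : Address → Tree → List Address
  descendants u s = map (u ++_) (pre s)

  ν-descendants : ∀ u {s} → subtree T u ≡ just s → ν T u ≡ length (descendants u s)
  ν-descendants u {s} e = trans (cong (maybe size 0) e) (sym (trans (length-map (u ++_) (pre s)) (length-pre s)))

  ∈-descendants : ∀ {u w s} → subtree T u ≡ just s → u ⊑ w → Vertex T w → w ∈ descendants u s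
  ∈-descendants {u} {s = s} e (q , refl) (r , e′) = ∈-map⁺ (u ++_) (∈-pre⁺ s q (trans (sym (subtree-++ T u q e)) e′))

  descendants-∈ : ∀ {u w s} → subtree T u ≡ just s → w ∈ descendants u s → u ⊑ w × Vertex T w
  descendants-∈ {u} {s = s} e w∈ with ∈-map⁻ (u ++_) w∈
  ... | q , q∈ , refl = (q , refl) , (let (r , e′) = ∈-pre⁻ s q∈ in r , trans (subtree-++ T u q e) e′)

  -- Only an inequality, since `k` may cut the subtree of `v` short.
  count≤ν : ∀ {i v k} → k ≤ n → v < k → lev v ≡ i → NoLev i (suc v) k → count i v k ≤ ν T (addr v)
  count≤ν {i} {v} {k} k≤n v<k lv nl with vertex (<-≤-trans v<k k≤n)
  ... | s , e = ≤-trans (≤-reflexive (sym (length-map addr (Il i v k))))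
                  (≤-trans (unique-length (addrs-unique (All.tabulate bound) (Il-unique i v k)) sub)
                    (≤-reflexive (sym (ν-descendants (addr v) e))))
    where
    bound : ∀ {x} → x ∈ Il i v k → x < n
    bound x∈ = <-≤-trans (proj₁ (proj₂ (∈-Il⁻ i v k x∈))) k≤n
    sub : ∀ {u} → u ∈ map addr (Il i v k) → u ∈ descendants (addr v) s
    sub u∈ with ∈-map⁻ addr u∈
    ... | x , x∈ , refl = let (v≤x , x<k , i≤) = ∈-Il⁻ i v k x∈ in
      ∈-descendants e (under k≤n v≤x x<k lv nl i≤) (vertex (<-≤-trans x<k k≤n))

  subtree-inside : ∀ {i v′ v w} → v < n → v′ < v → lev v′ ≡ i → lev v ≡ i → addr v′ ⊑ w → Vertex T w →
                   ∃ λ y → v′ ≤ y × y < v × i ≤ lev y × addr y ≡ w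
  subtree-inside {w = w} v<n v′<v lv′ lv p vw with position {w} vw
  ... | y , y<n , refl = y , ⊑⇒≤ (<-trans v′<v v<n) p , disjoint y<n p (trans lv′ (sym lv)) v′<v ,
                         ≤-trans (≤-reflexive (sym lv′)) (⊑-length p) , refl

  -- The subtree of `v′` is complete before its cousin `v`. Together with `count≤ν` this has the
  -- right direction for T1-T3, which bound a possibly truncated subtree by complete ones.
  ν≤count : ∀ {i v′ v} → v < n → v′ < v → lev v′ ≡ i → lev v ≡ i → ν T (addr v′) ≤ count i v′ v
  ν≤count {i} {v′} {v} v<n v′<v lv′ lv with vertex (<-trans v′<v v<n)
  ... | s , e = ≤-trans (≤-reflexive (ν-descendants (addr v′) e))
                  (≤-trans (unique-length (Uniqueₚ.map⁺ (λ {x} {y} → ++-cancelˡ (addr v′) x y) (pre-unique s)) sub)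
                    (≤-reflexive (length-map addr (Il i v′ v))))
    where
    sub : ∀ {u} → u ∈ descendants (addr v′) s → u ∈ map addr (Il i v′ v)
    sub {u} u∈ with descendants-∈ e u∈
    ... | p , vu with subtree-inside v<n v′<v lv′ lv p vu
    ...   | y , v′≤y , y<v , i≤ , refl = ∈-map⁺ addr (∈-Il⁺ i v′ v v′≤y y<v i≤)

  module _ (ks : IsKsTree 4 1 T) where
    open IsKsTree ks

    host : Host
    host = record
      { n        = n
      ; lev      = lev
      ; _~_      = _~_
      ; ~-sym    = λ {x} {y} → ~-sym {x} {y}
      ; lev-step = lev-step
      ; hub      = hub
      ; clique   = clique
      ; two-left = two-left
      ; quarter  = quarter
      ; deeper   = deeper
      ; fertile  = fertile
      }
      where
      Next : ℕ → ℕ → ℕ → Set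
      Next i u v = u < v × lev u ≡ i × NoLev i (suc u) v

      left : ∀ {i v′ v} → v < n → Next i v′ v → lev v ≡ i → NL T (addr v) (addr v′)
      left v<n (v′<v , lv′ , nl) refl = nearest-left v<n v′<v lv′ nl

      two-left : ∀ {i v″ v′ v k} → Next i v″ v′ → Next i v′ v → lev v ≡ i → v < k → k ≤ n → NoLev i (suc v) k →
                 count i v k ≤ count i v′ v + count i v″ v′
      two-left {i} {v″} {v′} {v} {k} nx″@(v″<v′ , lv″ , _) nx′@(v′<v , lv′ , _) lv v<k k≤n nl =
        ≤-trans (count≤ν k≤n v<k lv nl) (≤-trans (T1 (addr v) (addr v′) (addr v″) (vertex v<n) (left v<n nx′ lv) (left v′<n nx″ lv′))
          (≤-trans (≤-reflexive (+-comm (ν T (addr v″)) _)) (+-mono-≤ (ν≤count v<n v′<v lv′ lv) (ν≤count v′<n v″<v′ lv″ lv′))))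
        where
        v<n = <-≤-trans v<k k≤n
        v′<n = <-trans v′<v v<n

      quarter : ∀ {i v′ v k} → Next i v′ v → lev v ≡ i → v < k → k ≤ n → NoLev i (suc v) k →
                count i v k ≤ 4 * count i v′ v
      quarter nx@(v′<v , lv′ , _) lv v<k k≤n nl =
        ≤-trans (count≤ν k≤n v<k lv nl) (≤-trans (T2 _ _ (vertex v<n) (left v<n nx lv)) (*-monoʳ-≤ 4 (ν≤count v<n v′<v lv′ lv)))
        where v<n = <-≤-trans v<k k≤n

      deeper : ∀ {i v′ v w k} → Next i v′ v → lev v ≡ i → v < n → lev w ≡ suc i → w < k → k ≤ n →
               NoLev (suc i) (suc w) k → count (suc i) w k ≤ count i v′ v
      deeper {v = v} {w} (v′<v , lv′ , _) lv v<n lw w<k k≤n nl =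
        ≤-trans (count≤ν k≤n w<k lw nl)
          (≤-trans (T3 _ (vertex (<-trans v′<v v<n)) (addr v , vertex v<n , trans lv (sym lv′) , addr-mono v′<v v<n)
                      (addr w) (vertex (<-≤-trans w<k k≤n)) (≤-reflexive (trans (+-comm _ 1) (trans (cong suc lv′) (sym lw)))))
            (ν≤count v<n v′<v lv′ lv))

      fertile : ∀ {i v′ v k} → Next i v′ v → lev v ≡ i → v < k → k ≤ n → NoLev i (suc v) k →
                1 ≤ count (suc i) v k → 2 ≤ count i v′ v
      fertile {i} {v′} {v} {k} nx@(v′<v , lv′ , nl′) lv v<k k≤n nl c with count-pos⁻ (suc i) v k c
      ... | x , v≤x , x<k , i<lx
        with ⊑-strict (under k≤n v≤x x<k lv nl (<⇒≤ i<lx)) (λ e → <-irrefl (trans (sym lv) (cong length e)) i<lx)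
      ... | s , r , ex
        with T4 (addr v) (addr v′) (vertex v<n)
               (s , Vertex-⊑ (r , trans (++-assoc (addr v) [ s ] r) (sym ex)) (vertex (<-≤-trans x<k k≤n)))
               (left v<n nx lv)
        where v<n = <-≤-trans v<k k≤n
      ... | s′ , vs′ with subtree-inside (<-≤-trans v<k k≤n) v′<v lv′ lv ([ s′ ] , refl) vs′
      ...   | y , v′≤y , y<v , _ , ey = ≤-trans (s≤s (∈-length (∈-Il⁺ (suc i) (suc v′) v v′<y y<v i<ly)))
                                          (≤-reflexive (sym (count-first i v′<v lv′ nl′)))
        where
        ly : lev y ≡ suc i
        ly = trans (cong length ey) (trans (length-++ (addr v′)) (trans (+-comm _ 1) (cong suc lv′)))
        i<ly : suc i ≤ lev y
        i<ly = ≤-reflexive (sym ly)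
        v′<y : v′ < y
        v′<y = ≤∧≢⇒< v′≤y (λ { refl → 1+n≢n (trans (sym ly) lv′) })

-- Reading the embedding off a placement

open Trees

mutual
  label : Address → Tree → LTree
  label u (node cs) = node u (labelL u 0 cs)

  labelL : Address → ℕ → List Tree → Forest
  labelL u j []       = []
  labelL u j (c ∷ cs) = label (u ∷ʳ j) c ∷ labelL u (suc j) cs

mutual
  ⟨label⟩ : ∀ u t → ⟨ label u t ⟩ ≡ size t
  ⟨label⟩ u (node cs) = cong suc (⟪labelL⟫ u 0 cs)

  ⟪labelL⟫ : ∀ u j cs → ⟪ labelL u j cs ⟫ ≡ sizeL cs
  ⟪labelL⟫ u j []       = refl
  ⟪labelL⟫ u j (c ∷ cs) = cong₂ _+_ (⟨label⟩ (u ∷ʳ j) c) (⟪labelL⟫ u (suc j) cs)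

module Read (_~_ : ℕ → ℕ → Set) (~-sym : ∀ {x y} → x ~ y → y ~ x) where
  open Realise _~_ ~-sym

  mutual
    Real-subtree : ∀ {L} u t q {s} → Real L (label u t) → subtree t q ≡ just s → Real L (label (u ++ q) s)
    Real-subtree u t         []      r          refl = subst (λ w → Real _ (label w t)) (sym (++-identityʳ u)) r
    Real-subtree u (node cs) (i ∷ q) (real _ h) e    = proj₂ (Hung-subtree u 0 cs i q h e)

    Hung-subtree : ∀ {L} u j cs i q {s} → Hung L u (labelL u j cs) → subtreeL cs i q ≡ just s →
                   Joined L u (u ∷ʳ (j + i)) × Real L (label (u ++ (j + i) ∷ q) s)
    Hung-subtree {L} u j (node c ∷ cs) zero q {s} ((jn , r) ∷ _) e rewrite +-identityʳ j =
      jn , subst (λ w → Real L (label w s)) (++-assoc u [ j ] q) (Real-subtree (u ∷ʳ j) (node c) q r e)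
    Hung-subtree {L} u j (c ∷ cs) (suc i) q (_ ∷ h) e rewrite +-suc j i = Hung-subtree u (suc j) cs i q h e

  Real⇒Placed-vertex : ∀ {L} S p → Real L (label [] S) → Vertex S p → Placed L p
  Real⇒Placed-vertex S p r (s@(node _) , e) = Real⇒Placed (Real-subtree [] S p r e)

  Real⇒Joined : ∀ {L} S p i → Real L (label [] S) → Vertex S (p ∷ʳ i) → Joined L p (p ∷ʳ i)
  Real⇒Joined S p i r (s , e) with subtree-prefix S p [ i ] (s , e)
  ... | node cs , e′ with Real-subtree [] S p r e′
  ...   | real _ h = proj₁ (Hung-subtree p 0 cs i [] h (trans (sym (subtree-++ S p [ i ] e′)) e))

  find : Placement → Address → ℕ
  find []            p = 0
  find ((q , j) ∷ L) p with ≡-dec _≟_ q p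
  ... | yes _ = j
  ... | no _  = find L p

  find-∈ : ∀ {L p} → Placed L p → (p , find L p) ∈ L
  find-∈ {(q , j) ∷ L} {p} (l , p∈ , _) with ≡-dec _≟_ q p
  find-∈ {(q , j) ∷ L} {p} (l , p∈ , _)         | yes refl = here refl
  find-∈ {(q , j) ∷ L} {p} (l , here refl , _)  | no q≢p   = contradiction refl q≢p
  find-∈ {(q , j) ∷ L} {p} (l , there p∈ , _)   | no _     = there (find-∈ (l , p∈ , _))

theorem5p4 : (T S : Tree) → IsKsTree 4 1 T → size S ≡ size T →
    ContainsTree 2 T S
theorem5p4 T S ks sizes = record { f = f ; vert = vert ; inj = inj ; edges = edges }
  where
  open Numbering T using (n; addr; lev; vertex; addr-injective; Il-unique; _~_; ~-sym)
  open Levels lev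
  open Realise _~_ (λ {x} {y} → ~-sym {x} {y})
  open Read _~_ (λ {x} {y} → ~-sym {x} {y})
  module H = Embed (Numbering.host T ks)

  all-positions : ∀ k → count 0 0 k ≡ k
  all-positions zero    = refl
  all-positions (suc k) = trans (cong length (Il-keep 0 0 k z≤n z≤n)) (cong suc (all-positions k))

  embedding : H.Emb 0 0 n (label [] S)
  embedding = H.embeds (suc (size S)) (label [] S) (s≤s (≤-reflexive (⟨label⟩ [] S))) ≤-refl
    -- There is no level before level `0`.
    (λ _ _ _ _ _ _ ())
    (trans (⟨label⟩ [] S) (trans sizes (trans (sym (length-pre T)) (sym (all-positions n)))))

  L₀ : Placement
  L₀ = H.Emb.place embedding

  ok : Real L₀ (label [] S)
  ok = H.Emb.ok embedding

  onto : map proj₂ L₀ ↭ Il 0 0 n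
  onto = H.Emb.onto embedding

  placed : ∀ {p} → Vertex S p → Placed L₀ p
  placed {p} = Real⇒Placed-vertex S p ok

  length-L₀ : length L₀ ≡ n
  length-L₀ = trans (sym (length-map proj₂ L₀)) (trans (↭-length onto) (all-positions n))

  position-bound : ∀ {p j} → (p , j) ∈ L₀ → j < n
  position-bound e∈ = proj₁ (proj₂ (∈-Il⁻ 0 0 n (∈-resp-↭ onto (∈-map⁺ proj₂ e∈))))

  -- `L₀` has as many entries as `S` has vertices and mentions all of them.
  one-position : ∀ {p j l} → (p , j) ∈ L₀ → (p , l) ∈ L₀ → j ≡ l
  one-position {p} {j} {l} e∈ e′∈ = decidable-stable (j ≟ l) λ j≢l →
    pigeonhole proj₁ (pre S) (pre-unique S)
      (λ {x} x∈ → let (k , x∈L , _) = placed (∈-pre⁻ S x∈) in ∈-map⁺ proj₁ x∈L)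
      (≤-reflexive (trans length-L₀ (trans (length-pre T) (trans (sym sizes) (sym (length-pre S))))))
      e∈ e′∈ refl (λ { refl → j≢l refl })

  -- `L₀` has `n` entries and covers all `n` positions.
  one-label : ∀ {p q j} → (p , j) ∈ L₀ → (q , j) ∈ L₀ → p ≡ q
  one-label {p} {q} {j} e∈ e′∈ = decidable-stable (≡-dec _≟_ p q) λ p≢q →
    pigeonhole proj₂ (Il 0 0 n) (Il-unique 0 0 n) (∈-resp-↭ (↭-sym onto))
      (≤-reflexive (trans length-L₀ (sym (all-positions n)))) e∈ e′∈ refl (λ { refl → p≢q refl })

  f : List ℕ → List ℕ
  f p = addr (find L₀ p)

  vert : ∀ p → Vertex S p → Vertex T (f p)
  vert p v = vertex (position-bound (find-∈ (placed v)))

  inj : ∀ p q → Vertex S p → Vertex S q → f p ≡ f q → p ≡ q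
  inj p q vp vq e = one-label (subst (λ j → (p , j) ∈ L₀) j≡ (find-∈ (placed vp))) (find-∈ (placed vq))
    where
    j≡ : find L₀ p ≡ find L₀ q
    j≡ = addr-injective (position-bound (find-∈ (placed vp))) (position-bound (find-∈ (placed vq))) e

  edges : ∀ p i → Vertex S (p ∷ʳ i) → Edge 2 T (f p) (f (p ∷ʳ i))
  edges p i v with Real⇒Joined S p i ok v
  ... | j , l , e∈ , e′∈ , j~l = subst₂ (λ j l → j ~ l)
          (one-position e∈ (find-∈ (j , e∈ , _))) (one-position e′∈ (find-∈ (l , e′∈ , _))) j~l
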